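{- The languages of linearly bounded graphs between an initial vertex and a finite set of final vertices are exactly the context-sensitive languages. That is: for every linearly bounded graph $G$, every vertex $i$ of $G$ and every finite set $F$ of vertices of $G$, the language $L(G,\{i\},F)$ is context-sensitive; and conversely, for every context-sensitive language $L$ there are a linearly bounded graph $G$, a vertex $i$ of $G$ and a finite set $F$ of vertices of $G$ such that $L=L(G,\{i\},F)$.
   Context: Graphs. A $\Sigma$-labeled graph is a set $G\subseteq V\times\Sigma\times V$ with $\Sigma$ finite and $V$ countable; its set of vertices (support) is the set of all sources and targets of its edges. Two graphs $G,H$ are isomorphic if there is a bijection $\rho:V_H\to V_G$ with $(x,a,y)\in H$ iff $(\rho(x),a,\rho(y))\in G$. For sets of vertices $I,F$, $L(G,I,F)$ is the set of words $w\in\Sigma^*$ labeling a path of $G$ from some vertex of $I$ to some vertex of $F$. The empty word is denoted $\varepsilon$. A context-sensitive language is one accepted by a nondeterministic linearly bounded Turing machine. Labeled linearly bounded Turing machines (LLBMs). An LLBM is a tuple $M=(\Gamma,\Sigma,[,],Q,q_0,F,\delta)$ where $\Gamma$ is a finite set of tape symbols, $\Sigma\subseteq\Gamma$ is the input alphabet, $[,]\notin\Gamma$ are the left and right end-markers, $Q$ is a finite set of control states disjoint from $\Gamma$, $q_0\in Q$ is the initial state, $F\subseteq Q$ is the set of final states, and $\delta$ is a finite set of labeled rules of the forms $pA\xrightarrow{\varepsilon}qB\pm$, $p[\,\xrightarrow{\varepsilon}q[+$, $p]\xrightarrow{\varepsilon}q]-$, $pB\xrightarrow{a}qAB$, $p]\xrightarrow{a}qA]$,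 $pA\xrightarrow{\varepsilon}q$, with $p,q\in Q$, $A,B\in\Gamma$, $\pm\in\{+,-\}$, $a\in\Sigma$. A configuration is a word $uqv$ with $q\in Q$, $v\neq\varepsilon$ and $uv\in[\Gamma^*]$ (left marker, then a word over $\Gamma$, then right marker). For $x\in\Sigma\cup\{\varepsilon\}$ the relation $\xrightarrow{x}$ on configurations consists of the following pairs, where $X,Y\in\Gamma\cup\{[,]\}$: $upXv\xrightarrow{x}uYqv$ if $pX\xrightarrow{x}qY+\in\delta$; $uCpXv\xrightarrow{x}uqCYv$ if $pX\xrightarrow{x}qY-\in\delta$; $upAv\xrightarrow{\varepsilon}uqv$ if $pA\xrightarrow{\varepsilon}q\in\delta$; $upXv\xrightarrow{a}uqAXv$ if $pX\xrightarrow{a}qAX\in\delta$. Normalized LLBMs. $M$ is normalized if $Q$ is the disjoint union of $Q_\Sigma$ (external states) and $Q_\varepsilon$ (internal states) such that $F\subseteq Q_\Sigma$, every rule labeled by a letter of $\Sigma$ has its left-hand state $p$ in $Q_\Sigma$, every rule labeled by $\varepsilon$ has its left-hand state $p$ in $Q_\varepsilon$, and for every $p\in Q_\varepsilon$ and $X\in\Gamma\cup\{[,]\}$ there is a rule of the form $pX\xrightarrow{\varepsilon}qY\pm$ in $\delta$. A configuration is external if its control state is in $Q_\Sigma$. Linearly bounded graphs. The transition graph of a normalized LLBM $M$ is $G_M=\{(c,a,c')\mid a\in\Sigma,\ c,c' \text{ external configurations, } c\xrightarrow{a\varepsilon^*}c'\}$, where $c\xrightarrow{a\varepsilon^*}c'$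 means one $a$-transition followed by finitely many (possibly zero) $\varepsilon$-transitions. A linearly bounded graph is any graph isomorphic to the transition graph of some normalized LLBM. -}

module Defs where

open import Data.Fin.Base using (Fin; toℕ)
open import Data.Fin.Properties using (toℕ-injective)
open import Data.List.Base using (List; []; _∷_; _++_; _∷ʳ_; map)
open import Data.List.Membership.Propositional using (_∈_)
open import Data.List.Relation.Unary.All using (All)
open import Data.Maybe.Base using (Maybe; just; nothing)
open import Data.Nat.Base using (ℕ; zero; suc; _*_)
open import Data.Nat.Properties using (suc-injective; *-cancelˡ-≡; even≢odd)
open import Data.Product.Base using (Σ; ∃; ∃₂; ∃-syntax; _×_; _,_; proj₁)
open import Data.Sum.Base using (_⊎_)
open import Function.Base using (_∘_)
open import Function.Bundles using (_↔_; _↣_; _⇔_; Bijection; Inverse; Injection; mk↣)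
open import Level using (0ℓ)
open import Relation.Binary.Bundles using (Setoid)
import Relation.Binary.Construct.On as On
open import Relation.Binary.Construct.Closure.ReflexiveTransitive using (Star)
open import Relation.Binary.PropositionalEquality
  using (_≡_; _≢_; refl; sym; trans; cong; setoid)
open import Relation.Nullary.Negation using (contradiction)
open import Relation.Unary using (Pred; _≐_)

Finite : Set → Set
Finite A = ∃[ n ] (A ↔ Fin n)

Countable : Set → Set
Countable A = A ↣ ℕ

private
  variable
    A B : Set

pair : ℕ → ℕ → ℕ
pair zero    n = suc (2 * n)
pair (suc m) n = 2 * pair m n

pair-injective : ∀ m m′ {n n′} → pair m n ≡ pair m′ n′ → m ≡ m′ × n ≡ n′
pair-injective zero    zero     eq = refl , *-cancelˡ-≡ _ _ 2 (suc-injective eq)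
pair-injective zero    (suc m′) {n} {n′} eq =
  contradiction (sym eq) (even≢odd (pair m′ n′) n)
pair-injective (suc m) zero     {n} {n′} eq =
  contradiction eq (even≢odd (pair m n) n′)
pair-injective (suc m) (suc m′) eq
  with refl , eq′ ← pair-injective m m′ (*-cancelˡ-≡ _ _ 2 eq) = refl , eq′

finite⇒countable : Finite A → Countable A
finite⇒countable (n , f) = mk↣ {to = toℕ ∘ Inverse.to f} λ {x} {y} eq →
  trans (sym (Inverse.strictlyInverseʳ f x))
    (trans (cong (Inverse.from f) (toℕ-injective eq)) (Inverse.strictlyInverseʳ f y))

×-countable : Countable A → Countable B → Countable (A × B)
×-countable {A} {B} f g = mk↣ {to = code} inj
  where
  open Injection using (to; injective)
  code : A × B → ℕ
  code (x , y) = pair (to f x) (to g y)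
  inj : ∀ {p q} → code p ≡ code q → p ≡ q
  inj {x , y} {x′ , y′} eq
    with eq₁ , eq₂ ← pair-injective (to f x) (to f x′) eq
    with refl ← injective f eq₁ | refl ← injective g eq₂ = refl

List-countable : Countable A → Countable (List A)
List-countable {A} f = mk↣ {to = code} (λ {xs} {ys} → inj xs ys)
  where
  open Injection f using (to; injective)
  code : List A → ℕ
  code []       = 0
  code (x ∷ xs) = suc (pair (to x) (code xs))
  inj : ∀ xs ys → code xs ≡ code ys → xs ≡ ys
  inj []       []       eq = refl
  inj (x ∷ xs) (y ∷ ys) eq
    with eq₁ , eq₂ ← pair-injective (to x) (to y) (suc-injective eq)
    with refl ← injective eq₁ | refl ← inj xs ys eq₂ = refl

record Graph (A : Set) : Set₁ where
  field
    V         : Set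
    countable : Countable V
    edge      : V → A → V → Set

open Graph public using (V; edge)

-- V is only the ambient set; the vertices are the endpoints of edges.
Vertices : (G : Graph A) → Pred (V G) 0ℓ
Vertices G x = (∃₂ λ a y → edge G x a y) ⊎ (∃₂ λ y a → edge G y a x)

-- The subset Vertices G as a setoid: proofs of membership are ignored.
VertexSetoid : Graph A → Setoid 0ℓ 0ℓ
VertexSetoid G = On.setoid {B = Σ (V G) (Vertices G)} (setoid (V G)) proj₁

record _≅_ (G H : Graph A) : Set where
  field
    ρ : Bijection (VertexSetoid H) (VertexSetoid G)
    preserves : ∀ (x y : Σ (V H) (Vertices H)) a →
      edge H (proj₁ x) a (proj₁ y) ⇔
      edge G (proj₁ (Bijection.to ρ x)) a (proj₁ (Bijection.to ρ y))

data Path (G : Graph A) : V G → List A → V G → Set where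
  []  : ∀ {x} → Path G x [] x
  _∷_ : ∀ {x y z a w} → edge G x a y → Path G y w z → Path G x (a ∷ w) z

Language : (G : Graph A) → (I F : Pred (V G) 0ℓ) → Pred (List A) 0ℓ
Language G I F w = ∃₂ λ x y → I x × F y × Path G x w y

data Symbol (Γ : Set) : Set where
  ⟦ ⟧ : Symbol Γ
  `_  : Γ → Symbol Γ

infix 9 `_

data Direction : Set where
  ⊕ ⊖ : Direction

-- (u , q , v) stands for the word u q v.
Triple : Set → Set → Set
Triple Γ Q = List (Symbol Γ) × Q × List (Symbol Γ)

Triple-countable : ∀ {Γ Q} → Finite Γ → Finite Q → Countable (Triple Γ Q)
Triple-countable {Γ} Γ-finite Q-finite =
  ×-countable tape (×-countable (finite⇒countable Q-finite) tape)
  where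
  open Injection (finite⇒countable Γ-finite) using (to; injective)
  code : Symbol Γ → ℕ
  code ⟦     = 0
  code ⟧     = 1
  code (` A) = suc (suc (to A))
  inj : ∀ {X Y} → code X ≡ code Y → X ≡ Y
  inj {⟦}   {⟦}   eq = refl
  inj {⟧}   {⟧}   eq = refl
  inj {` A} {` B} eq = cong `_ (injective (suc-injective (suc-injective eq)))
  tape : Countable (List (Symbol Γ))
  tape = List-countable (mk↣ inj)

IsConfiguration : ∀ {Γ Q} → Pred (Triple Γ Q) 0ℓ
IsConfiguration (u , q , v) =
  v ≢ [] × ∃[ γ ] u ++ v ≡ ⟦ ∷ map `_ γ ∷ʳ ⟧

-- (p , X ↦ q , Y , d) is the rule pX → qYd.
data Move (Γ Q : Set) : Set where
  _,_↦_,_,_ : (p : Q) (X : Symbol Γ) (q : Q) (Y : Symbol Γ) (d : Direction) → Move Γ Q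

data ValidMove {Γ Q : Set} : Pred (Move Γ Q) 0ℓ where
  inner : ∀ {p q A B d} → ValidMove (p , ` A ↦ q , ` B , d)
  left  : ∀ {p q} → ValidMove (p , ⟦ ↦ q , ⟦ , ⊕)
  right : ∀ {p q} → ValidMove (p , ⟧ ↦ q , ⟧ , ⊖)

data MoveStep {Γ Q : Set} : Move Γ Q → Triple Γ Q → Triple Γ Q → Set where
  forward  : ∀ {p X q Y u v} →
    MoveStep (p , X ↦ q , Y , ⊕) (u , p , X ∷ v) (u ∷ʳ Y , q , v)
  backward : ∀ {p X q Y u v C} →
    MoveStep (p , X ↦ q , Y , ⊖) (u ∷ʳ C , p , X ∷ v) (u , q , C ∷ Y ∷ v)

-- The only cells available are those of the input and the end-markers.
record LBM (A : Set) : Set₁ where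
  field
    Γ Q      : Set
    Γ-finite : Finite Γ
    Q-finite : Finite Q
    input    : A ↣ Γ
    q₀       : Q
    F        : List Q
    δ        : List (Move Γ Q)
    δ-valid  : All ValidMove δ

  Step : Triple Γ Q → Triple Γ Q → Set
  Step c d = ∃[ r ] r ∈ δ × MoveStep r c d

  initial : List A → Triple Γ Q
  initial w = [] , q₀ , ⟦ ∷ map (`_ ∘ Injection.to input) w ∷ʳ ⟧

  Accepts : Pred (List A) 0ℓ
  Accepts w = ∃[ u ] ∃[ q ] ∃[ v ] q ∈ F × Star Step (initial w) (u , q , v)

ContextSensitive : Pred (List A) 0ℓ → Set₁
ContextSensitive {A} L = Σ (LBM A) λ M → L ≐ LBM.Accepts M

data Rule (A Γ Q : Set) : Set where
  move   : Move Γ Q → Rule A Γ Q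
  insert : (p : Q) (X : Symbol Γ) (a : A) (q : Q) (B : Γ) → Rule A Γ Q  -- pX –a→ qBX
  delete : (p : Q) (B : Γ) (q : Q) → Rule A Γ Q                         -- pB –ε→ q

data ValidRule {A Γ Q : Set} : Pred (Rule A Γ Q) 0ℓ where
  move   : ∀ {m} → ValidMove m → ValidRule (move m)
  insert : ∀ {p C a q B} → ValidRule (insert p (` C) a q B)
  insert⟧ : ∀ {p a q B} → ValidRule (insert p ⟧ a q B)
  delete : ∀ {p B q} → ValidRule (delete p B q)

source : ∀ {A Γ Q} → Rule A Γ Q → Q
source (move (p , _ ↦ _ , _ , _)) = p
source (insert p _ _ _ _)         = p
source (delete p _ _)             = p

-- nothing is the empty word.
label : ∀ {A Γ Q} → Rule A Γ Q → Maybe A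
label (move _)           = nothing
label (insert _ _ a _ _) = just a
label (delete _ _ _)     = nothing

data RuleStep {A Γ Q : Set} : Rule A Γ Q → Triple Γ Q → Triple Γ Q → Set where
  move   : ∀ {m c d} → MoveStep m c d → RuleStep (move m) c d
  insert : ∀ {p X a q B u v} →
    RuleStep (insert p X a q B) (u , p , X ∷ v) (u , q , ` B ∷ X ∷ v)
  delete : ∀ {p B q u v} →
    RuleStep (delete p B q) (u , p , ` B ∷ v) (u , q , v)

record LLBM (A : Set) : Set₁ where
  field
    Γ Q      : Set
    Γ-finite : Finite Γ
    Q-finite : Finite Q
    input    : A ↣ Γ
    q₀       : Q
    F        : List Q
    δ        : List (Rule A Γ Q)
    δ-valid  : All ValidRule δ

  Step : Maybe A → Triple Γ Q → Triple Γ Q → Set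
  Step x c d = ∃[ r ] r ∈ δ × label r ≡ x × RuleStep r c d

data Kind : Set where
  external internal : Kind

record Normalized (M : LLBM A) : Set where
  open LLBM M
  field
    kind          : Q → Kind
    F-external    : All (λ q → kind q ≡ external) F
    letter-source : ∀ {r a} → r ∈ δ → label r ≡ just a → kind (source r) ≡ external
    ε-source      : ∀ {r} → r ∈ δ → label r ≡ nothing → kind (source r) ≡ internal
    total         : ∀ p X → kind p ≡ internal →
                    ∃[ q ] ∃[ Y ] ∃[ d ] move (p , X ↦ q , Y , d) ∈ δ

  ExternalConfiguration : Pred (Triple Γ Q) 0ℓ
  ExternalConfiguration c@(_ , q , _) = IsConfiguration c × kind q ≡ external

-- Steps by valid rules preserve IsConfiguration, so it is enough to require it
-- of the endpoints of an edge.
transitionGraph : (M : LLBM A) → Normalized M → Graph A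
transitionGraph M N = record
  { V         = Triple Γ Q
  ; countable = Triple-countable Γ-finite Q-finite
  ; edge      = λ c a c′ →
      ExternalConfiguration c × ExternalConfiguration c′ ×
      ∃[ d ] Step (just a) c d × Star (Step nothing) d c′
  }
  where
  open LLBM M
  open Normalized N

LinearlyBounded : Graph A → Set₁
LinearlyBounded {A} G =
  Σ (LLBM A) λ M → Σ (Normalized M) λ N → G ≅ transitionGraph M N

{-# OPTIONS --safe #-}

-- From graphs to machines: a run of an LLBM on w that starts in a fixed
-- configuration c fits into |w| cells plus a constant number of cells, which an
-- LBM keeps in its finite control.  To avoid programming that LBM directly, the
-- run is first encoded as rewriting of adjacent pairs of symbols in a string that
-- holds the configuration followed by the unread letters: an insertion uses up
-- the cell of the letter it reads, and a deletion leaves a blank.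
--
-- From machines to graphs: an LLBM copies the word to its tape by insertions,
-- guesses where the word ends, simulates the LBM by ε-rules and, on acceptance,
-- erases the tape to reach a single final configuration.  The empty word cannot
-- reach that configuration, so the initial vertex is made final if the LBM
-- accepts the empty word, which is decidable as its tape is then ⟦⟧.
module Submission where

open import Defs
open import Data.Empty using (⊥)
open import Data.Fin.Base using (Fin)
open import Data.Fin.Patterns
open import Data.Fin.Properties using (+↔⊎; *↔×; 1↔⊤)
open import Data.List.Base
  using (List; []; _∷_; [_]; _++_; _∷ʳ_; _ʳ++_; map; mapMaybe; concatMap; replicate; length;
         allFin; cartesianProduct; initLast; _∷ʳ′_)
open import Data.List.Extrema.Nat using (max; xs≤max)
open import Data.List.Membership.Propositional using (_∈_; lose; find)
open import Data.List.Membership.Propositional.Properties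
  using (∈-map⁺; ∈-map⁻; ∈-allFin; ∈-cartesianProduct⁺; ∈-concat⁺′)
import Data.List.Membership.DecPropositional as DecMembership
open import Data.List.Properties
  using (∷-injective; ∷-injectiveʳ; ∷ʳ-injective; ++-assoc; ++-identityʳ; ++-conicalʳ;
         map-∘; map-++; map-injective; mapMaybe-++; length-++; length-map; length-replicate)
open import Data.List.Relation.Unary.All using (All; []; _∷_)
import Data.List.Relation.Unary.All as All
open import Data.List.Relation.Unary.All.Properties using (map⁺)
open import Data.List.Relation.Unary.Any using (Any; here; there; any?)
open import Data.Maybe.Base using (Maybe; just; nothing)
open import Data.Maybe.Properties using (just-injective)
open import Data.Nat.Base using (ℕ; zero; suc; _+_; _≤_; z≤n; s≤s)
open import Data.Nat.Properties using (+-suc; +-assoc; +-cancelˡ-≡) renaming (_≟_ to _≟ℕ_)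
open import Data.Product.Base using (Σ; ∃₂; ∃-syntax; _×_; _,_; proj₁; proj₂)
open import Data.Product.Function.NonDependent.Propositional using (_×-↔_)
open import Data.Sum.Base using (_⊎_; inj₁; inj₂)
open import Data.Sum.Function.Propositional using (_⊎-↔_)
open import Data.Unit.Base using (⊤; tt)
open import Data.Vec.Base as Vec using (Vec; []; _∷_; toList)
open import Data.Vec.Properties using (length-toList)
open import Function.Base using (_∘_; id)
open import Function.Bundles
  using (_↔_; _↣_; mk↣; mk↔ₛ′; Inverse; Injection; Bijection; Equivalence)
open import Function.Construct.Identity using (bijection; ⇔-id)
open import Function.Properties.Inverse using (↔-sym; ↔-trans)
open import Level using (0ℓ)
open import Relation.Binary.Construct.Closure.ReflexiveTransitive
  using (Star; ε; _◅_; _◅◅_; gmap)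
open import Relation.Binary.Definitions using (Decidable; DecidableEquality)
open import Relation.Binary.PropositionalEquality
  using (_≡_; _≢_; refl; sym; trans; cong; cong₂; subst; subst₂; module ≡-Reasoning)
open import Relation.Nullary.Decidable
  using (Dec; yes; no; map′; _⊎-dec_; _×-dec_; via-injection)
open import Relation.Nullary.Negation using (contradiction)
open import Relation.Unary using (Pred; _≐_; ｛_｝)

-- Finite types

-- The tape of an LLBM changes its length, while a pair rewriting keeps the length of the string, so
-- cells must pass between the tape and the unread input. Letters and blanks travel through the tape
-- for this, and intermediate strings need not be encoded configurations; soundness rests on two
-- projections of the string that do not see this traffic. As length is conserved, the string always
-- has `N` + |w| cells, where `N` bounds the encodings of the initial and the final configurations:
-- a prefix of `N` cells lives in the control, and the others take exactly the cells of the input.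
--
-- In the converse direction, an edge is one letter followed by ε-steps, so the whole computation of
-- the LBM has to belong to the edge of the last letter. This is why the end of the word is guessed
-- right after an insertion, and why the empty word is a case apart. Totality of the internal states
-- is met by moves into a dead state. One further letter rule makes the final configuration a vertex
-- even if no word leads to it.

variable
  A B Γ Q : Set

Fin-finite : ∀ {n} → Finite (Fin n)
Fin-finite {n} = n , mk↔ₛ′ (λ i → i) (λ i → i) (λ _ → refl) (λ _ → refl)

Finite-resp-↔ : A ↔ B → Finite B → Finite A
Finite-resp-↔ f (n , g) = n , ↔-trans f g

⊤-finite : Finite ⊤
⊤-finite = 1 , ↔-sym 1↔⊤

⊎-finite : Finite A → Finite B → Finite (A ⊎ B)
⊎-finite (_ , f) (_ , g) = _ , ↔-trans (f ⊎-↔ g) (↔-sym +↔⊎)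

×-finite : Finite A → Finite B → Finite (A × B)
×-finite (_ , f) (_ , g) = _ , ↔-trans (f ×-↔ g) (↔-sym *↔×)

Maybe-finite : Finite A → Finite (Maybe A)
Maybe-finite A-finite = Finite-resp-↔ Maybe↔⊤⊎ (⊎-finite ⊤-finite A-finite)
  where
  Maybe↔⊤⊎ : Maybe A ↔ (⊤ ⊎ A)
  Maybe↔⊤⊎ = mk↔ₛ′
    (λ { nothing → inj₁ tt ; (just x) → inj₂ x })
    (λ { (inj₁ tt) → nothing ; (inj₂ x) → just x })
    (λ { (inj₁ tt) → refl ; (inj₂ x) → refl })
    (λ { nothing → refl ; (just x) → refl })

Symbol-finite : Finite Γ → Finite (Symbol Γ)
Symbol-finite Γ-finite = Finite-resp-↔ Symbol↔Maybe² (Maybe-finite (Maybe-finite Γ-finite))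
  where
  Symbol↔Maybe² : Symbol Γ ↔ Maybe (Maybe Γ)
  Symbol↔Maybe² = mk↔ₛ′
    (λ { ⟦ → nothing ; ⟧ → just nothing ; (` X) → just (just X) })
    (λ { nothing → ⟦ ; (just nothing) → ⟧ ; (just (just X)) → ` X })
    (λ { nothing → refl ; (just nothing) → refl ; (just (just X)) → refl })
    (λ { ⟦ → refl ; ⟧ → refl ; (` X) → refl })

Vec-finite : Finite A → ∀ n → Finite (Vec A n)
Vec-finite A-finite zero =
  Finite-resp-↔ (mk↔ₛ′ (λ _ → tt) (λ _ → []) (λ _ → refl) λ { [] → refl }) ⊤-finite
Vec-finite A-finite (suc n) =
  Finite-resp-↔
    (mk↔ₛ′ (λ v → Vec.head v , Vec.tail v) (λ (x , xs) → x ∷ xs) (λ _ → refl) λ { (x ∷ xs) → refl })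
    (×-finite A-finite (Vec-finite A-finite n))

Listable : Set → Set
Listable A = ∃[ xs ] ∀ (x : A) → x ∈ xs

finite⇒listable : Finite A → Listable A
finite⇒listable (n , f) = map (Inverse.from f) (allFin n) , λ x →
  subst (_∈ _) (Inverse.strictlyInverseʳ f x) (∈-map⁺ (Inverse.from f) (∈-allFin (Inverse.to f x)))

-- Zipper configurations

after : List Γ → List (Symbol Γ)
after β = map `_ β ∷ʳ ⟧

-- The argument lists the tape leftwards, starting next to the head.
before : List Γ → List (Symbol Γ)
before []      = ⟦ ∷ []
before (X ∷ α) = before α ∷ʳ ` X

-- Valid configurations as zippers: the head is on ⟦ (start), or on the first
-- symbol of after β with before α to its left (at).
data Conf (Γ Q : Set) : Set where
  start : Q → List Γ → Conf Γ Q
  at    : List Γ → Q → List Γ → Conf Γ Q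

⌊_⌋ : Conf Γ Q → Triple Γ Q
⌊ start q γ ⌋ = [] , q , ⟦ ∷ after γ
⌊ at α q β ⌋  = before α , q , after β

content : Conf Γ Q → List Γ
content (start q γ) = γ
content (at α q β)  = α ʳ++ β

before++after : ∀ (α : List Γ) β → before α ++ after β ≡ ⟦ ∷ after (α ʳ++ β)
before++after []      β = refl
before++after (X ∷ α) β = trans (++-assoc (before α) (` X ∷ []) (after β)) (before++after α (X ∷ β))

after≢[] : ∀ (β : List Γ) → after β ≢ []
after≢[] []      ()
after≢[] (X ∷ β) ()

⌊⌋-isConfiguration : (z : Conf Γ Q) → IsConfiguration ⌊ z ⌋
⌊⌋-isConfiguration (start q γ) = (λ ()) , γ , refl
⌊⌋-isConfiguration (at α q β)  = after≢[] β , α ʳ++ β , before++after α β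

isConfiguration⇒⌊⌋ : ∀ (c : Triple Γ Q) → IsConfiguration c → ∃[ z ] c ≡ ⌊ z ⌋
isConfiguration⇒⌊⌋ ([] , q , v) (v≢[] , γ , refl) = start q γ , refl
isConfiguration⇒⌊⌋ (X ∷ u , q , v) (v≢[] , γ , eq)
  with refl , eq′ ← ∷-injective eq = scan [] u γ eq′
  where
  scan : ∀ α u γ → u ++ v ≡ after γ → ∃[ z ] (before α ++ u , q , v) ≡ ⌊ z ⌋
  scan α []      γ       refl = at α q γ , cong (_, q , after γ) (++-identityʳ (before α))
  -- A nonempty rest of `u` would already contain `⟧`, leaving nothing for `v`.
  scan α (Y ∷ u) []      eq = contradiction (++-conicalʳ u v (∷-injectiveʳ eq)) v≢[]
  scan α (Y ∷ u) (Z ∷ γ) eq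
    with refl , eq′ ← ∷-injective eq
    with z , eq″ ← scan (Z ∷ α) u γ eq′ =
    z , trans (cong (_, q , v) (sym (++-assoc (before α) (` Z ∷ []) u))) eq″

-- The head on the first symbol of after β moves left.
retreat : List Γ → Q → List Γ → Conf Γ Q
retreat []      q β = start q β
retreat (C ∷ α) q β = at α q (C ∷ β)

-- Lists only what a valid rule can do to a valid configuration, so the head cannot leave the
-- end-markers.
data _⊢ₘ_⟶_ {Γ Q : Set} : Move Γ Q → Conf Γ Q → Conf Γ Q → Set where
  start⊕ : ∀ {p q γ} → (p , ⟦ ↦ q , ⟦ , ⊕) ⊢ₘ start p γ ⟶ at [] q γ
  at⊕    : ∀ {p q X Y α β} → (p , ` X ↦ q , ` Y , ⊕) ⊢ₘ at α p (X ∷ β) ⟶ at (Y ∷ α) q β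
  at⊖    : ∀ {p q X Y α β} → (p , ` X ↦ q , ` Y , ⊖) ⊢ₘ at α p (X ∷ β) ⟶ retreat α q (Y ∷ β)
  end⊖   : ∀ {p q α} → (p , ⟧ ↦ q , ⟧ , ⊖) ⊢ₘ at α p [] ⟶ retreat α q []

data _⊢_⟶_ {A Γ Q : Set} : Rule A Γ Q → Conf Γ Q → Conf Γ Q → Set where
  move   : ∀ {m c d} → m ⊢ₘ c ⟶ d → move m ⊢ c ⟶ d
  insert : ∀ {p X a q B α β} → insert p (` X) a q B ⊢ at α p (X ∷ β) ⟶ at α q (B ∷ X ∷ β)
  insert⟧ : ∀ {p a q B α} → insert p ⟧ a q B ⊢ at α p [] ⟶ at α q (B ∷ [])
  delete : ∀ {p q B α β} → delete p B q ⊢ at α p (B ∷ β) ⟶ at α q β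

⌊⌋-move : ∀ {m : Move Γ Q} {z z′} → m ⊢ₘ z ⟶ z′ → MoveStep m ⌊ z ⌋ ⌊ z′ ⌋
⌊⌋-move start⊕             = forward
⌊⌋-move at⊕                = forward
⌊⌋-move (at⊖ {α = []})     = backward {u = []}
⌊⌋-move (at⊖ {α = C ∷ α})  = backward
⌊⌋-move (end⊖ {α = []})    = backward {u = []}
⌊⌋-move (end⊖ {α = C ∷ α}) = backward

⌊⌋-rule : ∀ {r : Rule A Γ Q} {z z′} → r ⊢ z ⟶ z′ → RuleStep r ⌊ z ⌋ ⌊ z′ ⌋
⌊⌋-rule (move step)          = move (⌊⌋-move step)
⌊⌋-rule insert               = insert
⌊⌋-rule insert⟧              = insert
⌊⌋-rule delete               = delete

before-∷ʳ⁻ : ∀ (α : List Γ) {u C} → u ∷ʳ C ≡ before α → ∀ (q : Q) β → (u , q , C ∷ after β) ≡ ⌊ retreat α q β ⌋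
before-∷ʳ⁻ []      {u} eq q β with refl , refl ← ∷ʳ-injective u [] eq = refl
before-∷ʳ⁻ (X ∷ α) {u} eq q β with refl , refl ← ∷ʳ-injective u (before α) eq = refl

∷ʳ≢[] : ∀ (u : List A) {C} → u ∷ʳ C ≢ []
∷ʳ≢[] []      ()
∷ʳ≢[] (_ ∷ _) ()

,-injective₃ : ∀ {u u′ : List A} {p p′ : Q} {v v′ : List B} →
  (u , p , v) ≡ (u′ , p′ , v′) → u ≡ u′ × p ≡ p′ × v ≡ v′
,-injective₃ refl = refl , refl , refl

-- The equation is a separate argument because matching on it gets stuck for moves to the left:
-- `u ∷ʳ C` and `before α` do not unify. That case goes through the injectivity of `_∷ʳ_`.
⌊⌋-move⁻ : ∀ {m : Move Γ Q} {c d} z → ValidMove m → MoveStep m c d → c ≡ ⌊ z ⌋ →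
  ∃[ z′ ] d ≡ ⌊ z′ ⌋ × m ⊢ₘ z ⟶ z′
⌊⌋-move⁻ (start p γ) inner forward ()
⌊⌋-move⁻ (at α p []) inner forward ()
⌊⌋-move⁻ (start p γ) left forward refl = at [] _ γ , refl , start⊕
⌊⌋-move⁻ (at α p (X ∷ β)) inner forward refl = at _ _ β , refl , at⊕
⌊⌋-move⁻ (at α p []) left forward ()
⌊⌋-move⁻ (at α p (X ∷ β)) left forward ()
⌊⌋-move⁻ (start p γ) inner (backward {u = u}) eq =
  contradiction (proj₁ (,-injective₃ eq)) (∷ʳ≢[] u)
⌊⌋-move⁻ (at α p (X ∷ β)) inner (backward {u = u}) eq
  with eq₁ , refl , refl ← ,-injective₃ eq = retreat α _ _ , before-∷ʳ⁻ α eq₁ _ (_ ∷ β) , at⊖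
⌊⌋-move⁻ (start p γ) right (backward {u = u}) eq =
  contradiction (proj₁ (,-injective₃ eq)) (∷ʳ≢[] u)
⌊⌋-move⁻ (at α p []) right backward eq
  with eq₁ , refl , refl ← ,-injective₃ eq = retreat α _ _ , before-∷ʳ⁻ α eq₁ _ [] , end⊖

⌊⌋-rule⁻ : ∀ {r : Rule A Γ Q} {d} z → ValidRule r → RuleStep r ⌊ z ⌋ d →
  ∃[ z′ ] d ≡ ⌊ z′ ⌋ × r ⊢ z ⟶ z′
⌊⌋-rule⁻ z (move valid) (move step)
  with z′ , eq , step′ ← ⌊⌋-move⁻ z valid step refl = z′ , eq , move step′
⌊⌋-rule⁻ (at α p (X ∷ β)) insert insert = at α _ _ , refl , insert
⌊⌋-rule⁻ (at α p []) insert⟧ insert = at α _ _ , refl , insert⟧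
⌊⌋-rule⁻ (at α p (X ∷ β)) delete delete = at α _ _ , refl , delete

-- Enumerations of rules

×-listable : Listable A → Listable B → Listable (A × B)
×-listable (xs , complete) (ys , complete′) =
  cartesianProduct xs ys , λ (x , y) → ∈-cartesianProduct⁺ (complete x) (complete′ y)

⊤-listable : Listable ⊤
⊤-listable = tt ∷ [] , λ _ → here refl

-- Instructions carry such membership proofs, so that inverting a step of the constructed machine
-- shows that the simulated rule exists.
Member : List A → Set
Member xs = ∃[ x ] x ∈ xs

Member-listable : (xs : List A) → Listable (Member xs)
Member-listable []       = [] , λ ()
Member-listable (x ∷ xs) =
  (x , here refl) ∷ map (λ (y , y∈xs) → y , there y∈xs) (proj₁ (Member-listable xs)) , λ where
    (y , here refl)  → here refl
    (y , there y∈xs) → there (∈-map⁺ _ (proj₂ (Member-listable xs) (y , y∈xs)))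

-- The rules of a machine are the images of an inductive type of instructions, listed family by
-- family. Membership of a rule then turns into a case split on instructions.
Family : Set → Set₁
Family I = ∃[ P ] Listable P × (P → I)

members : ∀ {I} → List (Family I) → List I
members = concatMap λ (_ , (ps , _) , f) → map f ps

∈-members : ∀ {I P l f} {fs : List (Family I)} → (P , l , f) ∈ fs → ∀ p → f p ∈ members fs
∈-members {l = ps , complete} {f} fs∋f p =
  ∈-concat⁺′ (∈-map⁺ f (complete p)) (∈-map⁺ (λ (_ , (ps , _) , f) → map f ps) fs∋f)

-- Machine steps on zippers

state : Conf Γ Q → Q
state (start q γ) = q
state (at α q β)  = q

module _ (M : LBM A) where
  private module M = LBM M

  infix 4 _⟶_
  _⟶_ : Conf M.Γ M.Q → Conf M.Γ M.Q → Set
  z ⟶ z′ = ∃[ m ] m ∈ M.δ × m ⊢ₘ z ⟶ z′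

  ⟶⇒Step : ∀ {z z′} → z ⟶ z′ → M.Step ⌊ z ⌋ ⌊ z′ ⌋
  ⟶⇒Step (m , m∈δ , step) = m , m∈δ , ⌊⌋-move step

  Step*⇒⟶* : ∀ z {c d} → c ≡ ⌊ z ⌋ → Star M.Step c d → ∃[ z′ ] d ≡ ⌊ z′ ⌋ × Star _⟶_ z z′
  Step*⇒⟶* z eq ε = z , eq , ε
  Step*⇒⟶* z refl ((m , m∈δ , step) ◅ steps)
    with z₁ , eq₁ , step₁ ← ⌊⌋-move⁻ z (All.lookup M.δ-valid m∈δ) step refl
    with z′ , eq′ , steps′ ← Step*⇒⟶* z₁ eq₁ steps
    = z′ , eq′ , (m , m∈δ , step₁) ◅ steps′

  start₀ : List A → Conf M.Γ M.Q
  start₀ w = start M.q₀ (map (Injection.to M.input) w)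

  AcceptsConf : Pred (List A) _
  AcceptsConf w = ∃[ z ] state z ∈ M.F × Star _⟶_ (start₀ w) z

  initial≡⌊start₀⌋ : ∀ w → M.initial w ≡ ⌊ start₀ w ⌋
  initial≡⌊start₀⌋ w = cong (λ v → [] , M.q₀ , ⟦ ∷ v ∷ʳ ⟧) (map-∘ w)

  AcceptsConf≐Accepts : AcceptsConf ≐ M.Accepts
  AcceptsConf≐Accepts = to , from
    where
    to : ∀ {w} → AcceptsConf w → M.Accepts w
    to {w} (z , q∈F , steps)
      with steps′ ← subst (λ c → Star M.Step c ⌊ z ⌋) (sym (initial≡⌊start₀⌋ w))
             (gmap ⌊_⌋ ⟶⇒Step steps)
      with z
    ... | start q γ = _ , q , _ , q∈F , steps′
    ... | at α q β  = _ , q , _ , q∈F , steps′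
    from : ∀ {w} → M.Accepts w → AcceptsConf w
    from {w} (_ , _ , _ , q∈F , steps)
      with Step*⇒⟶* (start₀ w) (initial≡⌊start₀⌋ w) steps
    ... | start q γ , refl , steps′ = start q γ , q∈F , steps′
    ... | at α q β  , refl , steps′ = at α q β  , q∈F , steps′

-- Rewriting of adjacent pairs

module Rewriting {S : Set} (R : List ((S × S) × (S × S))) where

  infix 4 _⇒_ _⇒*_
  data _⇒_ : List S → List S → Set where
    here  : ∀ {x y x′ y′ s} → ((x , y) , (x′ , y′)) ∈ R → x ∷ y ∷ s ⇒ x′ ∷ y′ ∷ s
    there : ∀ {x s t} → s ⇒ t → x ∷ s ⇒ x ∷ t

  _⇒*_ : List S → List S → Set
  _⇒*_ = Star _⇒_

  ++-⇒ : ∀ r {s t} → s ⇒ t → r ++ s ⇒ r ++ t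
  ++-⇒ []      step = step
  ++-⇒ (x ∷ r) step = there (++-⇒ r step)

  ʳ++-⇒ : ∀ r {s t} → s ⇒ t → r ʳ++ s ⇒ r ʳ++ t
  ʳ++-⇒ []      step = step
  ʳ++-⇒ (x ∷ r) step = ʳ++-⇒ r (there step)

  -- Act K o K′: a rewriting step that touches the prefix K of a string and
  -- turns it into K′; if it straddles the end of K, then o = just (y , y′)
  -- says that the symbol y following K has to be replaced by y′.
  data Act : ∀ {n} → Vec S n → Maybe (S × S) → Vec S n → Set where
    inside : ∀ {n x y x′ y′} {K : Vec S n} → ((x , y) , (x′ , y′)) ∈ R →
             Act (x ∷ y ∷ K) nothing (x′ ∷ y′ ∷ K)
    across : ∀ {x y x′ y′} → ((x , y) , (x′ , y′)) ∈ R →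
             Act (x ∷ []) (just (y , y′)) (x′ ∷ [])
    there  : ∀ {n x o} {K K′ : Vec S n} → Act K o K′ → Act (x ∷ K) o (x ∷ K′)

  SomeAct : ℕ → Set
  SomeAct n = ∃[ K ] ∃[ o ] ∃[ K′ ] Act {n} K o K′

  SomeAct-listable : Finite S → ∀ n → Listable (SomeAct n)
  SomeAct-listable S-finite zero          = [] , λ ()
  SomeAct-listable S-finite (suc zero)    = members (family ∷ []) , λ where
      (_ , _ , _ , across r∈R) → ∈-members {fs = family ∷ []} (here refl) (_ , r∈R)
    where
    family : Family (SomeAct 1)
    family = _ , Member-listable R , λ (_ , r∈R) → _ , _ , _ , across r∈R
  SomeAct-listable S-finite (suc (suc n)) = extend (SomeAct-listable S-finite (suc n))
    where
    extend : Listable (SomeAct (suc n)) → Listable (SomeAct (suc (suc n)))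
    extend acts = members families , λ where
        (_ , _ , _ , inside r∈R) → ∈-members {fs = families} (here refl) ((_ , r∈R) , _)
        (_ , _ , _ , there act)  → ∈-members {fs = families} (there (here refl)) (_ , _ , _ , _ , act)
      where
      families : List (Family (SomeAct (suc (suc n))))
      families =
        (_ , ×-listable (Member-listable R) (finite⇒listable (Vec-finite S-finite n)) ,
           λ ((_ , r∈R) , K) → _ , _ , _ , inside {K = K} r∈R) ∷
        (_ , ×-listable (finite⇒listable S-finite) acts ,
           λ (x , _ , _ , _ , act) → _ , _ , _ , there {x = x} act) ∷ []

  Act-nothing⇒ : ∀ {n} {K K′ : Vec S n} → Act K nothing K′ → ∀ γ → toList K ++ γ ⇒ toList K′ ++ γ
  Act-nothing⇒ (inside r∈R) γ = here r∈R
  Act-nothing⇒ (there act)  γ = there (Act-nothing⇒ act γ)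

  Act-just⇒ : ∀ {n y y′} {K K′ : Vec S n} → Act K (just (y , y′)) K′ →
              ∀ γ → toList K ++ y ∷ γ ⇒ toList K′ ++ y′ ∷ γ
  Act-just⇒ (across r∈R) γ = here r∈R
  Act-just⇒ (there act)  γ = there (Act-just⇒ act γ)

  -- The three cases are the three ways in which the LBM below carries out a step: in the control
  -- alone, in the control and the first tape cell, or on the tape alone.
  data Split {n} (K : Vec S n) : List S → List S → Set where
    inside  : ∀ {K′ γ} → Act K nothing K′ → Split K γ (toList K′ ++ γ)
    across  : ∀ {K′ y y′ γ} → Act K (just (y , y′)) K′ → Split K (y ∷ γ) (toList K′ ++ y′ ∷ γ)
    outside : ∀ {γ γ′} → γ ⇒ γ′ → Split K γ (toList K ++ γ′)

  split : ∀ {n} (K : Vec S n) {γ t} → toList K ++ γ ⇒ t → Split K γ t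
  split []          step         = outside step
  split (x ∷ [])    (here r∈R)   = across (across r∈R)
  split (x ∷ y ∷ K) (here r∈R)   = inside (inside r∈R)
  split (x ∷ K)     (there step) with split K step
  ... | inside act    = inside (there act)
  ... | across act    = across (there act)
  ... | outside step′ = outside step′

  -- An LBM for rewriting to a target

  module ToLBM (S-finite : Finite S) (letter : A ↣ S) (blank : S)
                  {n} (K₀ : Vec S n) (targets : List (Vec S n)) where

    open Injection letter using () renaming (to to cell)

    RewritesToTarget : List S → Set
    RewritesToTarget s = ∃₂ λ K m → K ∈ targets × s ⇒* toList K ++ replicate m blank

    -- run K o is the state with K in the control: if o = just (y , y′), then
    -- the scanned symbol has to be y and is to be replaced by y′.
    State : Set
    State = Maybe (Maybe (Vec S n × Maybe (S × S)))

    pattern accept  = nothing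
    pattern sweep   = just nothing
    pattern run K o = just (just (K , o))

    State-finite : Finite State
    State-finite = Maybe-finite (Maybe-finite (×-finite (Vec-finite S-finite n)
      (Maybe-finite (×-finite S-finite S-finite))))

    data Instruction : Set where
      act    : SomeAct n → Instruction
      enter  : Vec S n → Instruction
      forth  : Vec S n × S → Instruction
      back   : Vec S n × S → Instruction
      bounce : Vec S n → Instruction
      first  : Vec S n × Member R → Instruction
      second : Vec S n × S × S → Instruction
      check  : Member targets → Instruction
      skip   : ⊤ → Instruction
      finish : ⊤ → Instruction

    opaque
      Instruction-listable : Listable Instruction
      Instruction-listable = members families , complete
        where
        prefixes : Listable (Vec S n)
        prefixes = finite⇒listable (Vec-finite S-finite n)
        symbols : Listable S
        symbols = finite⇒listable S-finite
        families : List (Family Instruction)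
        families =
          (_ , SomeAct-listable S-finite n , act) ∷
          (_ , prefixes , enter) ∷
          (_ , ×-listable prefixes symbols , forth) ∷
          (_ , ×-listable prefixes symbols , back) ∷
          (_ , prefixes , bounce) ∷
          (_ , ×-listable prefixes (Member-listable R) , first) ∷
          (_ , ×-listable prefixes (×-listable symbols symbols) , second) ∷
          (_ , Member-listable targets , check) ∷
          (_ , ⊤-listable , skip) ∷
          (_ , ⊤-listable , finish) ∷ []
        cover : ∀ {P l f} → (P , l , f) ∈ families → ∀ p → f p ∈ members families
        cover = ∈-members {fs = families}
        complete : ∀ i → i ∈ members families
        complete (act x) = cover (here refl) x
        complete (enter x) = cover (there (here refl)) x
        complete (forth x) = cover (there (there (here refl))) x
        complete (back x) = cover (there (there (there (here refl)))) x
        complete (bounce x) = cover (there (there (there (there (here refl))))) x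
        complete (first x) = cover (there (there (there (there (there (here refl)))))) x
        complete (second x) = cover (there (there (there (there (there (there (here refl))))))) x
        complete (check x) = cover (there (there (there (there (there (there (there (here refl)))))))) x
        complete (skip x) = cover (there (there (there (there (there (there (there (there (here refl))))))))) x
        complete (finish x) = cover (there (there (there (there (there (there (there (there (there (here refl)))))))))) x

    -- A pair on the tape is rewritten by two moves: `first` changes the left symbol and stores in
    -- the state what is due at the right one. Only `second` leaves such a state, so a wrong choice
    -- gets stuck. `act` uses the same device for a pair that straddles the end of the prefix.
    ⟪_⟫ : Instruction → Move S State
    ⟪ act (K , o , K′ , _) ⟫                 = run K nothing , ⟦ ↦ run K′ o , ⟦ , ⊕
    ⟪ enter K ⟫                              = run K nothing , ⟦ ↦ run K nothing , ⟦ , ⊕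
    ⟪ forth (K , x) ⟫                        = run K nothing , ` x ↦ run K nothing , ` x , ⊕
    ⟪ back (K , x) ⟫                         = run K nothing , ` x ↦ run K nothing , ` x , ⊖
    ⟪ bounce K ⟫                             = run K nothing , ⟧ ↦ run K nothing , ⟧ , ⊖
    ⟪ first (K , ((x , y) , (x′ , y′)) , _) ⟫ =
      run K nothing , ` x ↦ run K (just (y , y′)) , ` x′ , ⊕
    ⟪ second (K , y , y′) ⟫ = run K (just (y , y′)) , ` y ↦ run K nothing , ` y′ , ⊖
    ⟪ check (K , _) ⟫       = run K nothing , ⟦ ↦ sweep , ⟦ , ⊕
    ⟪ skip _ ⟫              = sweep , ` blank ↦ sweep , ` blank , ⊕
    ⟪ finish _ ⟫            = sweep , ⟧ ↦ accept , ⟧ , ⊖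

    ⟪⟫-valid : ∀ i → ValidMove ⟪ i ⟫
    ⟪⟫-valid (act _)    = left
    ⟪⟫-valid (enter _)  = left
    ⟪⟫-valid (forth _)  = inner
    ⟪⟫-valid (back _)   = inner
    ⟪⟫-valid (bounce _) = right
    ⟪⟫-valid (first _)  = inner
    ⟪⟫-valid (second _) = inner
    ⟪⟫-valid (check _)  = left
    ⟪⟫-valid (skip _)   = inner
    ⟪⟫-valid (finish _) = right

    machine : LBM A
    machine = record
      { Γ = S ; Q = State ; Γ-finite = S-finite ; Q-finite = State-finite
      ; input = letter ; q₀ = run K₀ nothing ; F = accept ∷ []
      ; δ = map ⟪_⟫ (proj₁ Instruction-listable)
      ; δ-valid = map⁺ (All.tabulate λ {i} _ → ⟪⟫-valid i)
      }

    infix 4 _⟼_ _⟼*_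
    _⟼_ : Conf S State → Conf S State → Set
    _⟼_ = _⟶_ machine

    _⟼*_ : Conf S State → Conf S State → Set
    _⟼*_ = Star _⟼_

    by : ∀ i {z z′} → ⟪ i ⟫ ⊢ₘ z ⟶ z′ → z ⟼ z′
    by i step = ⟪ i ⟫ , ∈-map⁺ ⟪_⟫ (proj₂ Instruction-listable i) , step

    rewind : ∀ {K} α γ → at α (run K nothing) γ ⟼* start (run K nothing) (α ʳ++ γ)
    rewind []      []      = by (bounce _) end⊖ ◅ ε
    rewind []      (x ∷ γ) = by (back _) at⊖ ◅ ε
    rewind (y ∷ α) []      = by (bounce _) end⊖ ◅ rewind α (y ∷ [])
    rewind (y ∷ α) (x ∷ γ) = by (back _) at⊖ ◅ rewind α (y ∷ x ∷ γ)

    rewrite-tape : ∀ {K α γ γ′} → γ ⇒ γ′ →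
      at α (run K nothing) γ ⟼* start (run K nothing) (α ʳ++ γ′)
    rewrite-tape {α = α} (here r∈R) =
      by (first (_ , _ , r∈R)) at⊕ ◅ by (second _) at⊖ ◅ rewind α _
    rewrite-tape (there step)       = by (forth _) at⊕ ◅ rewrite-tape step

    -- Each rewriting step becomes an excursion of the head from `⟦` and back. Rewriting keeps the
    -- length, so the cut between control and tape stays at the same place.
    ⇒*-⟼* : ∀ {K s t} γ → s ≡ toList K ++ γ → s ⇒* t → ∃₂ λ K′ γ′ →
      t ≡ toList K′ ++ γ′ × start (run K nothing) γ ⟼* start (run K′ nothing) γ′
    ⇒*-⟼* γ eq ε = _ , γ , eq , ε
    ⇒*-⟼* {K} γ refl (step ◅ steps) with split K step
    ... | inside act′
      with K′ , γ′ , eq , run′ ← ⇒*-⟼* γ refl steps =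
      K′ , γ′ , eq , by (act (_ , _ , _ , act′)) start⊕ ◅ rewind [] γ ◅◅ run′
    ... | across act′
      with K′ , γ′ , eq , run′ ← ⇒*-⟼* _ refl steps =
      K′ , γ′ , eq , by (act (_ , _ , _ , act′)) start⊕ ◅ by (second _) at⊖ ◅ run′
    ... | outside step′
      with K′ , γ′ , eq , run′ ← ⇒*-⟼* _ refl steps =
      K′ , γ′ , eq , by (enter _) start⊕ ◅ rewrite-tape step′ ◅◅ run′

    toList-++-injective : ∀ {k} (K K′ : Vec S k) {γ γ′} →
      toList K ++ γ ≡ toList K′ ++ γ′ → K ≡ K′ × γ ≡ γ′
    toList-++-injective []      []        eq = refl , eq
    toList-++-injective (x ∷ K) (x′ ∷ K′) eq
      with refl , eq′ ← ∷-injective eq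
      with refl , refl ← toList-++-injective K K′ eq′ = refl , refl

    sweep-blanks : ∀ α m → ∃[ z ] state z ≡ accept × at α sweep (replicate m blank) ⟼* z
    sweep-blanks []      zero    = start accept [] , refl , by (finish tt) end⊖ ◅ ε
    sweep-blanks (x ∷ α) zero    = at α accept (x ∷ []) , refl , by (finish tt) end⊖ ◅ ε
    sweep-blanks α       (suc m)
      with z , eq , steps ← sweep-blanks (blank ∷ α) m = z , eq , by (skip tt) at⊕ ◅ steps

    rewrites⇒accepts : ∀ {w} → RewritesToTarget (toList K₀ ++ map cell w) → AcceptsConf machine w
    rewrites⇒accepts {w} (K , m , K∈targets , steps)
      with K′ , γ′ , eq , run₁ ← ⇒*-⟼* (map cell w) refl steps
      with refl , refl ← toList-++-injective K K′ eq
      with z , eq′ , run₂ ← sweep-blanks [] m =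
      z , here eq′ , run₁ ◅◅ by (check (K , K∈targets)) start⊕ ◅ run₂

    module _ (s₀ : List S) where

      -- With a replacement pending, the tape is half rewritten, so the invariant speaks of the
      -- string after `second`. In `sweep`, all cells to the left of the head are blank, which at
      -- `⟧` means the whole tape. The clauses `⊤` suffice because no instruction leaves these
      -- states on `⟦`.
      Invariant : Conf S State → Set
      Invariant z with state z
      ... | run K nothing = s₀ ⇒* toList K ++ content z
      ... | accept        = RewritesToTarget s₀
      Invariant (start _ γ) | run K (just _) = ⊤
      Invariant (at α _ β)  | run K (just (y , y′)) =
        ∀ β′ → β ≡ y ∷ β′ → s₀ ⇒* toList K ++ (α ʳ++ (y′ ∷ β′))
      Invariant (start _ γ) | sweep = ⊤
      Invariant (at α _ β)  | sweep = ∃₂ λ K m → K ∈ targets ×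
        α ≡ replicate m blank × s₀ ⇒* toList K ++ (α ʳ++ β)

      retreat-run : ∀ {K} α {β} → s₀ ⇒* toList K ++ (α ʳ++ β) → Invariant (retreat α (run K nothing) β)
      retreat-run []      r = r
      retreat-run (x ∷ α) r = r

      retreat-accept : ∀ α {β} → RewritesToTarget s₀ → Invariant (retreat α accept β)
      retreat-accept []      r = r
      retreat-accept (x ∷ α) r = r

      replicate-ʳ++ : ∀ k {m} → replicate k blank ʳ++ replicate m blank ≡ replicate (k + m) blank
      replicate-ʳ++ zero        = refl
      replicate-ʳ++ (suc k) {m} = trans (replicate-ʳ++ k) (cong (λ l → replicate l blank) (+-suc k m))

      preserved : ∀ {z z′} i → ⟪ i ⟫ ⊢ₘ z ⟶ z′ → Invariant z → Invariant z′
      preserved (act (K , nothing , K′ , a)) start⊕ r = r ◅◅ Act-nothing⇒ a _ ◅ ε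
      preserved (act (K , just _ , K′ , a)) start⊕ r = λ where
        β refl → r ◅◅ Act-just⇒ a β ◅ ε
      preserved (enter K) start⊕ r = r
      preserved (forth _) at⊕ r = r
      preserved (back _) (at⊖ {α = α}) r = retreat-run α r
      preserved (bounce _) (end⊖ {α = α}) r = retreat-run α r
      preserved (first (K , _ , r∈R)) (at⊕ {α = α}) r = λ where
        β refl → r ◅◅ ++-⇒ (toList K) (ʳ++-⇒ α (here r∈R)) ◅ ε
      preserved (second _) (at⊖ {α = α} {β}) r = retreat-run α (r β refl)
      preserved (check (K , K∈targets)) start⊕ r = K , 0 , K∈targets , refl , r
      preserved (skip tt) at⊕ (K , m , K∈targets , refl , r) = K , suc m , K∈targets , refl , r
      -- At `⟧` the part to the right is empty, that is `replicate 0 blank`; hence `m + 0`.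
      preserved (finish tt) (end⊖ {α = α}) (K , m , K∈targets , refl , r) =
        retreat-accept α (K , m + 0 , K∈targets ,
          subst (λ s → s₀ ⇒* toList K ++ s) (replicate-ʳ++ m) r)

      preserved* : ∀ {z z′} → z ⟼* z′ → Invariant z → Invariant z′
      preserved* ε                        r = r
      preserved* ((_ , m∈δ , step) ◅ run′) r
        with i , _ , refl ← ∈-map⁻ ⟪_⟫ m∈δ = preserved* run′ (preserved i step r)

    accepts⇒rewrites : ∀ {w} → AcceptsConf machine w → RewritesToTarget (toList K₀ ++ map cell w)
    accepts⇒rewrites (start accept γ , here refl , run′) = preserved* _ run′ ε
    accepts⇒rewrites (at α accept β , here refl , run′)  = preserved* _ run′ ε

    rewriting-contextSensitive : ContextSensitive λ w → RewritesToTarget (toList K₀ ++ map cell w)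
    rewriting-contextSensitive = machine ,
      (λ r → proj₁ (AcceptsConf≐Accepts machine) (rewrites⇒accepts r)) ,
      (λ a → accepts⇒rewrites (proj₂ (AcceptsConf≐Accepts machine) a))

-- LLBM runs as rewriting

map-∷ʳ⁻ : ∀ {f : A → B} (xs : List A) {ys y} → map f xs ≡ ys ∷ʳ y →
  ∃₂ λ xs′ x → xs ≡ xs′ ∷ʳ x × map f xs′ ≡ ys × f x ≡ y
map-∷ʳ⁻ {f = f} xs {ys} eq with initLast xs
... | [] = contradiction (sym eq) (∷ʳ≢[] ys)
... | xs′ ∷ʳ′ x = xs′ , x , refl , ∷ʳ-injective _ ys (trans (sym (map-++ f xs′ [ x ])) eq)

map-∷ʳ-++ : ∀ (f : A → B) xs {x ys} → map f (xs ∷ʳ x) ++ ys ≡ map f xs ++ f x ∷ ys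
map-∷ʳ-++ f xs {x} {ys} = trans (cong (_++ ys) (map-++ f xs [ x ])) (++-assoc (map f xs) [ f x ] ys)

module Simulation (A-finite : Finite A) (M : LLBM A) where
  private module M = LLBM M

  data Run : Triple M.Γ M.Q → List A → Triple M.Γ M.Q → Set where
    []    : ∀ {c} → Run c [] c
    _ε∷_  : ∀ {c d w e} → M.Step nothing c d → Run d w e → Run c w e
    _∷_   : ∀ {c d a w e} → M.Step (just a) c d → Run d w e → Run c (a ∷ w) e

  Step-isConfiguration : ∀ {x c d} → M.Step x c d → IsConfiguration c → IsConfiguration d
  Step-isConfiguration {c = c} (r , r∈δ , _ , step) c-conf
    with z , refl ← isConfiguration⇒⌊⌋ c c-conf
    with z′ , refl , _ ← ⌊⌋-rule⁻ z (All.lookup M.δ-valid r∈δ) step = ⌊⌋-isConfiguration z′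

  -- The state shares a cell with the scanned symbol, so that every rule touches just two adjacent
  -- cells.
  data Cell : Set where
    tape   : Symbol M.Γ → Cell
    head   : M.Q → Symbol M.Γ → Cell
    letter : A → Cell
    blank  : Cell

  opaque
    Cell-finite : Finite Cell
    Cell-finite = Finite-resp-↔
      (mk↔ₛ′
        (λ { (tape X) → inj₁ X ; (head p X) → inj₂ (inj₁ (p , X))
           ; (letter a) → inj₂ (inj₂ (just a)) ; blank → inj₂ (inj₂ nothing) })
        (λ { (inj₁ X) → tape X ; (inj₂ (inj₁ (p , X))) → head p X
           ; (inj₂ (inj₂ (just a))) → letter a ; (inj₂ (inj₂ nothing)) → blank })
        (λ { (inj₁ X) → refl ; (inj₂ (inj₁ (p , X))) → refl
           ; (inj₂ (inj₂ (just a))) → refl ; (inj₂ (inj₂ nothing)) → refl })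
        (λ { (tape X) → refl ; (head p X) → refl ; (letter a) → refl ; blank → refl }))
      (⊎-finite (Symbol-finite M.Γ-finite)
        (⊎-finite (×-finite M.Q-finite (Symbol-finite M.Γ-finite)) (Maybe-finite A-finite)))

  letter↣ : A ↣ Cell
  letter↣ = mk↣ {to = letter} λ { refl → refl }

  encode : List (Symbol M.Γ) → M.Q → Symbol M.Γ → List (Symbol M.Γ) → List Cell
  encode u q X v = map tape u ++ head q X ∷ map tape v

  data Local : Set where
    simulate : Member M.δ × Symbol M.Γ → Local
    hop      : Symbol M.Γ × A → Local
    sink     : Cell → Local

  opaque
    Local-listable : Listable Local
    Local-listable = members families , λ where
        (simulate x) → cover (here refl) x
        (hop x)      → cover (there (here refl)) x
        (sink x)     → cover (there (there (here refl))) x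
      where
      symbols : Listable (Symbol M.Γ)
      symbols = finite⇒listable (Symbol-finite M.Γ-finite)
      families : List (Family Local)
      families =
        (_ , ×-listable (Member-listable M.δ) symbols , simulate) ∷
        (_ , ×-listable symbols (finite⇒listable A-finite) , hop) ∷
        (_ , finite⇒listable Cell-finite , sink) ∷ []
      cover : ∀ {P l f} → (P , l , f) ∈ families → ∀ p → f p ∈ members families
      cover = ∈-members {fs = families}

  -- Unread letters travel to the left, but never across the head, so that they
  -- are consumed in the right order.
  ⟪_⟫ : Local → (Cell × Cell) × (Cell × Cell)
  ⟪ simulate ((move (p , X ↦ q , Y , ⊕) , _) , Z) ⟫ = (head p X , tape Z) , (tape Y , head q Z)
  ⟪ simulate ((move (p , X ↦ q , Y , ⊖) , _) , C) ⟫ = (tape C , head p X) , (head q C , tape Y)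
  ⟪ simulate ((insert p X a q B , _) , _) ⟫ = (head p X , letter a) , (head q (` B) , tape X)
  ⟪ simulate ((delete p B q , _) , Z) ⟫     = (head p (` B) , tape Z) , (head q Z , blank)
  ⟪ hop (X , a) ⟫ = (tape X , letter a) , (letter a , tape X)
  ⟪ sink x ⟫      = (blank , x) , (x , blank)

  R : List ((Cell × Cell) × (Cell × Cell))
  R = map ⟪_⟫ (proj₁ Local-listable)

  open Rewriting R

  local : ∀ i → ⟪ i ⟫ ∈ R
  local i = ∈-map⁺ ⟪_⟫ (proj₂ Local-listable i)

  ++-⇒* : ∀ r {s t} → s ⇒* t → r ++ s ⇒* r ++ t
  ++-⇒* r = gmap (r ++_) (++-⇒ r)

  hop* : ∀ v a {s} → map tape v ++ letter a ∷ s ⇒* letter a ∷ map tape v ++ s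
  hop* []      a = ε
  hop* (X ∷ v) a = ++-⇒* [ tape X ] (hop* v a) ◅◅ here (local (hop (X , a))) ◅ ε

  sink* : ∀ r {s} → blank ∷ r ++ s ⇒* r ++ blank ∷ s
  sink* []      = ε
  sink* (x ∷ r) = here (local (sink x)) ◅ ++-⇒* [ x ] (sink* r)

  replicate-sink* : ∀ j r → replicate j blank ++ r ⇒* r ++ replicate j blank
  replicate-sink* zero    r = subst (r ⇒*_) (sym (++-identityʳ r)) ε
  replicate-sink* (suc j) r = ++-⇒* [ blank ] (replicate-sink* j r) ◅◅ sink* r

  cells : Triple M.Γ M.Q → List Cell → List Cell
  cells (u , q , [])    s = map tape u ++ s
  cells (u , q , X ∷ v) s = map tape u ++ head q X ∷ map tape v ++ s

  cells-⇒* : ∀ c {s t} → s ⇒* t → cells c s ⇒* cells c t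
  cells-⇒* (u , q , [])    steps = ++-⇒* (map tape u) steps
  cells-⇒* (u , q , X ∷ v) steps = ++-⇒* (map tape u) (++-⇒* (head q X ∷ map tape v) steps)

  unread : List A → ℕ → List Cell
  unread w k = map letter w ++ replicate k blank

  -- The normal form between steps is: configuration, unread letters, blanks. A deletion puts a
  -- blank next to the head, and sinking it past the tape and the unread letters restores this form.
  -- That `d` is a configuration provides the neighbouring cell onto which the head moves.
  simulate-ε : ∀ {c d} w k → IsConfiguration d → M.Step nothing c d →
    ∃[ k′ ] cells c (unread w k) ⇒* cells d (unread w k′)
  simulate-ε w k d-conf (move (p , X ↦ q , Y , ⊕) , r∈δ , _ , move (forward {u = u} {[]})) =
    contradiction refl (proj₁ d-conf)
  simulate-ε w k d-conf (move (p , X ↦ q , Y , ⊕) , r∈δ , _ , move (forward {u = u} {Z ∷ v})) =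
    k , subst (_ ⇒*_) (sym (map-∷ʳ-++ tape u))
      (++-⇒ (map tape u) (here (local (simulate ((_ , r∈δ) , Z)))) ◅ ε)
  simulate-ε w k d-conf (move (p , X ↦ q , Y , ⊖) , r∈δ , _ , move (backward {u = u} {C = C})) =
    k , subst (_⇒* _) (sym (map-∷ʳ-++ tape u))
      (++-⇒ (map tape u) (here (local (simulate ((_ , r∈δ) , C)))) ◅ ε)
  simulate-ε w k d-conf (delete p B q , r∈δ , _ , delete {v = []}) = contradiction refl (proj₁ d-conf)
  simulate-ε w k d-conf (delete p B q , r∈δ , _ , delete {u = u} {Z ∷ v}) =
    suc k , ++-⇒* (map tape u)
      (here (local (simulate ((_ , r∈δ) , Z))) ◅
       ++-⇒* [ head q Z ] (sink* (map tape v) ◅◅ ++-⇒* (map tape v) (sink* (map letter w))))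

  simulate-letter : ∀ {c d a} s → M.Step (just a) c d → cells c (letter a ∷ s) ⇒* cells d s
  simulate-letter s (insert p X a q B , r∈δ , refl , insert {u = u} {v}) =
    ++-⇒* (map tape u) (++-⇒* [ head p X ] (hop* v a) ◅◅
      here (local (simulate ((_ , r∈δ) , X))) ◅ ε)

  simulate-run : ∀ {c w e} k → IsConfiguration c → Run c w e →
    ∃[ k′ ] cells c (unread w k) ⇒* cells e (unread [] k′)
  simulate-run k c-conf [] = _ , ε
  simulate-run {w = w} k c-conf (step ε∷ run)
    with d-conf ← Step-isConfiguration step c-conf
    with k₁ , steps ← simulate-ε w k d-conf step
    with k′ , steps′ ← simulate-run k₁ d-conf run = k′ , steps ◅◅ steps′
  simulate-run k c-conf (step ∷ run)
    with d-conf ← Step-isConfiguration step c-conf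
    with k′ , steps ← simulate-run k d-conf run = k′ , simulate-letter _ step ◅◅ steps

  -- `track` and `mark` are projections that hops and sinks leave unchanged: the former keeps the
  -- configuration, the latter the unread letters and the place of the head among them. Together
  -- they decode strings in which letters and blanks are scattered over the tape.
  track : Cell → Maybe Cell
  track (tape X)   = just (tape X)
  track (head p X) = just (head p X)
  track (letter a) = nothing
  track blank      = nothing

  -- nothing stands for the head.
  mark : Cell → Maybe (Maybe A)
  mark (tape X)   = nothing
  mark (head p X) = just nothing
  mark (letter a) = just (just a)
  mark blank      = nothing

  -- All unread letters are to the right of the head.
  data Decodes (s : List Cell) : Triple M.Γ M.Q → List A → Set where
    decodes : ∀ {u q X v w} → mapMaybe track s ≡ encode u q X v →
              mapMaybe mark s ≡ nothing ∷ map just w → Decodes s (u , q , X ∷ v) w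

  no-head : ∀ v l {p X r} → map tape v ≢ l ++ head p X ∷ r
  no-head []      []      ()
  no-head []      (x ∷ l) ()
  no-head (Z ∷ v) []      ()
  no-head (Z ∷ v) (x ∷ l) eq = no-head v l (proj₂ (∷-injective eq))

  -- An encoded configuration has a single head cell, so the head that a rewriting rule sees is that
  -- of the decoded configuration.
  unique-head : ∀ u {q X v} l {p Y r} → encode u q X v ≡ l ++ head p Y ∷ r →
    map tape u ≡ l × q ≡ p × X ≡ Y × map tape v ≡ r
  unique-head []      []      refl = refl , refl , refl , refl
  unique-head []      {v = v} (x ∷ l) eq = contradiction (proj₂ (∷-injective eq)) (no-head v l)
  unique-head (Z ∷ u) []      ()
  unique-head (Z ∷ u) (x ∷ l) eq
    with refl , eq′ ← ∷-injective eq
    with refl , eqs ← unique-head u l eq′ = refl , eqs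

  tape-injective : ∀ {u v} → map tape u ≡ map tape v → u ≡ v
  tape-injective = map-injective λ { refl → refl }

  ⇒⁻ : ∀ {s t} → s ⇒ t → ∃₂ λ l r → ∃₂ λ x y → ∃₂ λ x′ y′ →
    ((x , y) , (x′ , y′)) ∈ R × s ≡ l ++ x ∷ y ∷ r × t ≡ l ++ x′ ∷ y′ ∷ r
  ⇒⁻ (here xy∈R) = [] , _ , _ , _ , _ , _ , xy∈R , refl , refl
  ⇒⁻ (there {x} step) with l , r , _ , _ , _ , _ , xy∈R , refl , refl ← ⇒⁻ step =
    x ∷ l , r , _ , _ , _ , _ , xy∈R , refl , refl

  -- No unread letter is to the left of the head, so the letter adjacent to the head is the first
  -- unread one. This is what keeps the order of reading.
  first-mark : ∀ ms {a : A} {ns w} → ms ++ nothing ∷ just a ∷ ns ≡ nothing ∷ map just w →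
    ∃[ w′ ] ms ≡ [] × w ≡ a ∷ w′ × ns ≡ map just w′
  first-mark [] {w = a ∷ w′} refl = w′ , refl , refl , refl
  first-mark (m ∷ ms) {w = w} eq = contradiction (proj₂ (∷-injective eq)) (no-nothing ms w)
    where
    no-nothing : ∀ ms w {ns} → ms ++ nothing ∷ ns ≢ map {A = A} just w
    no-nothing []       (a ∷ w) ()
    no-nothing (m ∷ ms) (a ∷ w) eq = no-nothing ms w (proj₂ (∷-injective eq))

  -- Stated by extension of runs because a simulated rule prepends one step to a run, while hops and
  -- sinks prepend nothing; the extensions then compose along a rewriting.
  Reflects : List Cell → Triple M.Γ M.Q → List A → Set
  Reflects t c w = ∃₂ λ d w′ → Decodes t d w′ × (∀ {e} → Run d w′ e → Run c w e)

  module _ (f : Cell → Maybe B) where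

    mapMaybe-pull : ∀ l {s ys} → mapMaybe f (l ++ s) ≡ ys → mapMaybe f l ++ mapMaybe f s ≡ ys
    mapMaybe-pull l {s} eq = trans (sym (mapMaybe-++ f l s)) eq

    mapMaybe-push : ∀ l {s ys} → mapMaybe f l ++ mapMaybe f s ≡ ys → mapMaybe f (l ++ s) ≡ ys
    mapMaybe-push l {s} eq = trans (mapMaybe-++ f l s) eq

  unchanged : ∀ l {s t c w} → mapMaybe track s ≡ mapMaybe track t → mapMaybe mark s ≡ mapMaybe mark t →
    Decodes (l ++ s) c w → Reflects (l ++ t) c w
  unchanged l eq₁ eq₂ (decodes tracks marks) = _ , _ , decodes
    (mapMaybe-push track l (trans (cong (_ ++_) (sym eq₁)) (mapMaybe-pull track l tracks)))
    (mapMaybe-push mark l (trans (cong (_ ++_) (sym eq₂)) (mapMaybe-pull mark l marks))) , id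

  sink-track : ∀ x r → mapMaybe track (blank ∷ x ∷ r) ≡ mapMaybe track (x ∷ blank ∷ r)
  sink-track (tape X)   r = refl
  sink-track (head p X) r = refl
  sink-track (letter a) r = refl
  sink-track blank      r = refl

  sink-mark : ∀ x r → mapMaybe mark (blank ∷ x ∷ r) ≡ mapMaybe mark (x ∷ blank ∷ r)
  sink-mark (tape X)   r = refl
  sink-mark (head p X) r = refl
  sink-mark (letter a) r = refl
  sink-mark blank      r = refl

  reflect : ∀ i l r {x y x′ y′ c w} → ((x , y) , (x′ , y′)) ≡ ⟪ i ⟫ →
    Decodes (l ++ x ∷ y ∷ r) c w → Reflects (l ++ x′ ∷ y′ ∷ r) c w
  reflect (hop _)  l r refl = unchanged l refl refl
  reflect (sink x) l r refl = unchanged l (sink-track x r) (sink-mark x r)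
  reflect (simulate ((move (p , X ↦ q , Y , ⊕) , r∈δ) , Z)) l r refl (decodes {u} {v = v} tracks marks)
    with v | unique-head u (mapMaybe track l) (sym (mapMaybe-pull track l tracks))
  ... | []     | _ , _ , _ , ()
  ... | Z′ ∷ v | eq , refl , refl , eq′ with refl , eq″ ← ∷-injective eq′ = _ , _ , decodes
    (mapMaybe-push track l (trans
      (cong₂ (λ l r → l ++ tape Y ∷ head q Z ∷ r) (sym eq) (sym eq″))
      (sym (map-∷ʳ-++ tape u))))
    (mapMaybe-push mark l (mapMaybe-pull mark l marks)) ,
    λ run → (_ , r∈δ , refl , move forward) ε∷ run
  reflect (simulate ((move (p , X ↦ q , Y , ⊖) , r∈δ) , C)) l r refl (decodes {u} tracks marks)
    -- The cell `C` is counted to the left of the head, which forces `u` to end in `C`.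
    with eq , refl , refl , eq′ ← unique-head u (mapMaybe track l ∷ʳ tape C)
           (trans (sym (mapMaybe-pull track l tracks))
             (sym (++-assoc (mapMaybe track l) [ tape C ] (head p X ∷ mapMaybe track r))))
    with u′ , C′ , refl , eq″ , refl ← map-∷ʳ⁻ u eq = _ , _ , decodes
    (mapMaybe-push track l (cong₂ (λ l r → l ++ head q C ∷ tape Y ∷ r) (sym eq″) (sym eq′)))
    (mapMaybe-push mark l (mapMaybe-pull mark l marks)) ,
    λ run → (_ , r∈δ , refl , move backward) ε∷ run
  reflect (simulate ((insert p X a q B , r∈δ) , _)) l r refl (decodes {u} tracks marks)
    with eq , refl , refl , eq′ ← unique-head u (mapMaybe track l) (sym (mapMaybe-pull track l tracks))
    with w′ , eq″ , refl , eq‴ ← first-mark (mapMaybe mark l) (mapMaybe-pull mark l marks) = _ , _ , decodes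
    (mapMaybe-push track l (cong₂ (λ l r → l ++ head q (` B) ∷ tape X ∷ r) (sym eq) (sym eq′)))
    (mapMaybe-push mark l (cong₂ (λ l r → l ++ nothing ∷ r) eq″ eq‴)) ,
    λ run → (_ , r∈δ , refl , insert) ∷ run
  reflect (simulate ((delete p B q , r∈δ) , Z)) l r refl (decodes {u} {v = v} tracks marks)
    with v | unique-head u (mapMaybe track l) (sym (mapMaybe-pull track l tracks))
  ... | []     | _ , _ , _ , ()
  ... | Z′ ∷ v | eq , refl , refl , eq′ with refl , eq″ ← ∷-injective eq′ = _ , _ , decodes
    (mapMaybe-push track l (cong₂ (λ l r → l ++ head q Z ∷ r) (sym eq) (sym eq″)))
    (mapMaybe-push mark l (mapMaybe-pull mark l marks)) ,
    λ run → (_ , r∈δ , refl , delete) ε∷ run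

  reflect* : ∀ {s t c w} → s ⇒* t → Decodes s c w → Reflects t c w
  reflect* ε              dec = _ , _ , dec , id
  reflect* (step ◅ steps) dec
    with l , r , _ , _ , _ , _ , xy∈R , refl , refl ← ⇒⁻ step
    with i , _ , eq ← ∈-map⁻ ⟪_⟫ xy∈R
    with _ , _ , dec₁ , run₁ ← reflect i l r eq dec
    with _ , _ , dec₂ , run₂ ← reflect* steps dec₁ = _ , _ , dec₂ , run₁ ∘ run₂

  encode-injective : ∀ {u q X v u′ q′ X′ v′} → encode u q X v ≡ encode u′ q′ X′ v′ →
    _≡_ {A = Triple M.Γ M.Q} (u , q , X ∷ v) (u′ , q′ , X′ ∷ v′)
  encode-injective {u} {u′ = u′} eq
    with eq₁ , refl , refl , eq₂ ← unique-head u (map tape u′) eq =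
    cong₂ (λ u v → u , _ , _ ∷ v) (tape-injective eq₁) (tape-injective eq₂)

  track-tape : ∀ u s → mapMaybe track (map tape u ++ s) ≡ map tape u ++ mapMaybe track s
  track-tape []      s = refl
  track-tape (X ∷ u) s = cong (tape X ∷_) (track-tape u s)

  mark-tape : ∀ u s → mapMaybe mark (map tape u ++ s) ≡ mapMaybe mark s
  mark-tape []      s = refl
  mark-tape (X ∷ u) s = mark-tape u s

  track-padding : ∀ j s → mapMaybe track (replicate j blank ++ s) ≡ mapMaybe track s
  track-padding zero    s = refl
  track-padding (suc j) s = track-padding j s

  mark-padding : ∀ j s → mapMaybe mark (replicate j blank ++ s) ≡ mapMaybe mark s
  mark-padding zero    s = refl
  mark-padding (suc j) s = mark-padding j s

  track-unread : ∀ w k → mapMaybe track (unread w k) ≡ []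
  track-unread []      zero    = refl
  track-unread []      (suc k) = track-unread [] k
  track-unread (a ∷ w) k       = track-unread w k

  mark-unread : ∀ w k → mapMaybe mark (unread w k) ≡ map just w
  mark-unread []      zero    = refl
  mark-unread []      (suc k) = mark-unread [] k
  mark-unread (a ∷ w) k       = cong (just a ∷_) (mark-unread w k)

  cells-decodes : ∀ {u q X v} j w k →
    Decodes (cells (u , q , X ∷ v) (replicate j blank ++ unread w k)) (u , q , X ∷ v) w
  cells-decodes {u} {q} {X} {v} j w k = decodes
    (trans (track-tape u _) (cong (λ s → map tape u ++ head q X ∷ s) (begin
      mapMaybe track (map tape v ++ replicate j blank ++ unread w k)   ≡⟨ track-tape v _ ⟩
      map tape v ++ mapMaybe track (replicate j blank ++ unread w k)
        ≡⟨ cong (map tape v ++_) (trans (track-padding j _) (track-unread w k)) ⟩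
      map tape v ++ []                                                 ≡⟨ ++-identityʳ _ ⟩
      map tape v                                                       ∎)))
    (trans (mark-tape u _) (cong (nothing ∷_)
      (trans (mark-tape v _) (trans (mark-padding j _) (mark-unread w k)))))
    where open ≡-Reasoning

  cells-++ : ∀ c s t → cells c s ++ t ≡ cells c (s ++ t)
  cells-++ (u , q , [])    s t = ++-assoc (map tape u) s t
  cells-++ (u , q , X ∷ v) s t = trans (++-assoc (map tape u) _ t)
    (cong (λ s → map tape u ++ head q X ∷ s) (++-assoc (map tape v) s t))

  -- Pads with blanks. Nothing is cut off in the application below, where `fits` bounds the length.
  fit : ∀ n → List Cell → Vec Cell n
  fit zero    s       = []
  fit (suc n) []      = blank ∷ fit n []
  fit (suc n) (x ∷ s) = x ∷ fit n s

  toList-fit : ∀ {n s} → length s ≤ n →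
    ∃[ j ] length s + j ≡ n × toList (fit n s) ≡ s ++ replicate j blank
  toList-fit {zero}  {[]}    z≤n = 0 , refl , refl
  toList-fit {suc n} {[]}    z≤n
    with j , eq , eq′ ← toList-fit {n} {[]} z≤n = suc j , cong suc eq , cong (blank ∷_) eq′
  toList-fit {suc n} {x ∷ s} (s≤s s≤n)
    with j , eq , eq′ ← toList-fit s≤n = j , cong suc eq , cong (x ∷_) eq′

  ⇒-length : ∀ {s t} → s ⇒ t → length s ≡ length t
  ⇒-length (here _)     = refl
  ⇒-length (there step) = cong suc (⇒-length step)

  ⇒*-length : ∀ {s t} → s ⇒* t → length s ≡ length t
  ⇒*-length ε              = refl
  ⇒*-length (step ◅ steps) = trans (⇒-length step) (⇒*-length steps)

  -- Fitting a run into a constant prefix and the cells of the input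

  module _ (c : Triple M.Γ M.Q) (c-conf : IsConfiguration c)
           (F : List (Triple M.Γ M.Q)) (F-conf : All IsConfiguration F) where

    opaque
      N : ℕ
      N = max 0 (map (λ d → length (cells d [])) (c ∷ F))

      fits : ∀ {d} → d ∈ c ∷ F → length (cells d []) ≤ N
      fits d∈ = All.lookup (xs≤max 0 _) (∈-map⁺ (λ d → length (cells d [])) d∈)

    prefix : Triple M.Γ M.Q → Vec Cell N
    prefix d = fit N (cells d [])

    open ToLBM Cell-finite letter↣ blank (prefix c) (map prefix F)
      using (RewritesToTarget; rewriting-contextSensitive)

    prefix-cells : ∀ {d} → d ∈ c ∷ F → ∃[ j ] length (cells d []) + j ≡ N ×
      (∀ s → toList (prefix d) ++ s ≡ cells d (replicate j blank ++ s))
    prefix-cells {d} d∈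
      with j , eq , eq′ ← toList-fit {s = cells d []} (fits d∈) = j , eq , λ s → begin
        toList (prefix d) ++ s                  ≡⟨ cong (_++ s) eq′ ⟩
        (cells d [] ++ replicate j blank) ++ s  ≡⟨ ++-assoc (cells d []) _ s ⟩
        cells d [] ++ replicate j blank ++ s    ≡⟨ cells-++ d [] _ ⟩
        cells d (replicate j blank ++ s)        ∎
      where open ≡-Reasoning

    -- By conservation of length, `N` + |w| cells are left at the end, of which the configuration
    -- `d` takes `N` minus `j`. The remaining blanks are `j` that fill the prefix and |w| that fill
    -- the tape, as a target requires.
    blanks-left : ∀ {d w k j} → length (cells d []) + j ≡ N →
      toList (prefix c) ++ map letter w ⇒* cells d (replicate k blank) → k ≡ j + length w
    blanks-left {d} {w} {k} {j} fits-d steps = +-cancelˡ-≡ (length (cells d [])) _ _ (begin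
      length (cells d []) + k                                ≡⟨ cong (length (cells d []) +_) (length-replicate k) ⟨
      length (cells d []) + length (replicate k blank)       ≡⟨ length-++ (cells d []) ⟨
      length (cells d [] ++ replicate k blank)               ≡⟨ cong length (cells-++ d [] _) ⟩
      length (cells d (replicate k blank))                   ≡⟨ ⇒*-length steps ⟨
      length (toList (prefix c) ++ map letter w)   ≡⟨ length-++ (toList (prefix c)) ⟩
      length (toList (prefix c)) + length (map letter w)
        ≡⟨ cong₂ _+_ (length-toList (prefix c)) (length-map _ w) ⟩
      N + length w                                           ≡⟨ cong (_+ length w) fits-d ⟨
      length (cells d []) + j + length w                     ≡⟨ +-assoc (length (cells d [])) j (length w) ⟩
      length (cells d []) + (j + length w)                   ∎)
      where open ≡-Reasoning

    run⇒rewrites : ∀ {w d} → d ∈ F → Run c w d → RewritesToTarget (toList (prefix c) ++ map letter w)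
    run⇒rewrites {w} {d} d∈F run
      with j , _ , prefix-c ← prefix-cells (here refl)
      with j′ , fits-d , prefix-d ← prefix-cells (there d∈F)
      with k , steps ← simulate-run j c-conf run
      -- The padding of the prefix stands between `c` and the word; sinking it behind the letters
      -- yields the normal form.
      with steps′ ← subst (_⇒* _) (sym (prefix-c _))
        (cells-⇒* c (replicate-sink* j (map letter w)) ◅◅ steps)
      with refl ← blanks-left {d} {w} fits-d steps′
      = prefix d , length w , ∈-map⁺ prefix d∈F ,
        subst (_ ⇒*_) (trans (cong (cells d) (replicate-+ j′)) (sym (prefix-d _))) steps′
      where
      replicate-+ : ∀ i {j} → replicate (i + j) blank ≡ replicate i blank ++ replicate j blank
      replicate-+ zero    = refl
      replicate-+ (suc i) = cong (blank ∷_) (replicate-+ i)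

    configuration-decodes : ∀ {d} → IsConfiguration d → ∀ j w k →
      Decodes (cells d (replicate j blank ++ unread w k)) d w
    configuration-decodes {_ , _ , []}    (v≢[] , _) j w k = contradiction refl v≢[]
    configuration-decodes {_ , _ , X ∷ v} d-conf     j w k = cells-decodes j w k

    Decodes-unique : ∀ {s d d′ w w′} → Decodes s d w → Decodes s d′ w′ → d ≡ d′ × w ≡ w′
    Decodes-unique (decodes tracks marks) (decodes tracks′ marks′) =
      encode-injective (trans (sym tracks) tracks′) ,
      map-injective just-injective (proj₂ (∷-injective (trans (sym marks) marks′)))

    rewrites⇒run : ∀ {w} → RewritesToTarget (toList (prefix c) ++ map letter w) → ∃[ d ] d ∈ F × Run c w d
    rewrites⇒run {w} (_ , m , K∈ , steps)
      with d , d∈F , refl ← ∈-map⁻ prefix K∈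
      with j , _ , prefix-c ← prefix-cells (here refl)
      with j′ , _ , prefix-d ← prefix-cells (there d∈F)
      with _ , _ , dec , run′ ← reflect*
        (subst₂ _⇒*_
          (trans (prefix-c _) (cong (λ s → cells c (replicate j blank ++ s)) (sym (++-identityʳ _))))
          (prefix-d _) steps)
        (configuration-decodes c-conf j w 0)
      -- The target string also decodes to `d` with no letter left, so the reflected run ends in `d`
      -- and has read all of `w`.
      with refl , refl ← Decodes-unique dec (configuration-decodes (All.lookup F-conf d∈F) j′ [] m)
      = d , d∈F , run′ []

    run-contextSensitive : ContextSensitive λ w → ∃[ d ] d ∈ F × Run c w d
    run-contextSensitive with B , to , from ← rewriting-contextSensitive =
      B , (λ (_ , d∈F , run′) → to (run⇒rewrites d∈F run′)) , (λ a → rewrites⇒run (from a))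

-- Graphs to machines

ContextSensitive-resp-≐ : {L L′ : Pred (List A) 0ℓ} → L ≐ L′ → ContextSensitive L′ → ContextSensitive L
ContextSensitive-resp-≐ (L⊆L′ , L′⊆L) (M , to , from) = M , to ∘ L⊆L′ , L′⊆L ∘ from

module Paths (A-finite : Finite A) (M : LLBM A) (N : Normalized M) where
  private
    module M = LLBM M
    module N = Normalized N
    H = transitionGraph M N

  open Simulation A-finite M

  vertex-external : ∀ {c} → Vertices H c → N.ExternalConfiguration c
  vertex-external (inj₁ (_ , _ , c-ext , _))     = c-ext
  vertex-external (inj₂ (_ , _ , _ , c-ext , _)) = c-ext

  ε*-run : ∀ {c d w e} → Star (M.Step nothing) c d → Run d w e → Run c w e
  ε*-run ε              run = run
  ε*-run (step ◅ steps) run = step ε∷ ε*-run steps run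

  path⇒run : ∀ {c w d} → Path H c w d → Run c w d
  path⇒run []                                    = []
  path⇒run ((_ , _ , _ , step , steps) ∷ path) = step ∷ ε*-run steps (path⇒run path)

  ε-kind : ∀ {c d} → M.Step nothing c d → N.kind (proj₁ (proj₂ c)) ≡ internal
  ε-kind (_ , r∈δ , eq , move forward)  = N.ε-source r∈δ eq
  ε-kind (_ , r∈δ , eq , move backward) = N.ε-source r∈δ eq
  ε-kind (_ , r∈δ , eq , delete)        = N.ε-source r∈δ eq

  letter-kind : ∀ {a c d} → M.Step (just a) c d → N.kind (proj₁ (proj₂ c)) ≡ external
  letter-kind (_ , r∈δ , eq , insert) = N.letter-source r∈δ eq

  -- The leading ε-steps are split off because they belong to the edge of the letter before them.
  -- They end in an external configuration: either the next step reads a letter, or the run is over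
  -- at `e`.
  run⇒path′ : ∀ {c w e} → IsConfiguration c → N.ExternalConfiguration e → Run c w e →
    ∃[ d ] N.ExternalConfiguration d × Star (M.Step nothing) c d × Path H d w e
  run⇒path′ {e = e} c-conf e-ext [] = e , e-ext , ε , []
  run⇒path′ c-conf e-ext (step ε∷ run)
    with d , d-ext , steps , path ← run⇒path′ (Step-isConfiguration step c-conf) e-ext run
    = d , d-ext , step ◅ steps , path
  run⇒path′ {c} c-conf e-ext (step ∷ run)
    with d , d-ext , steps , path ← run⇒path′ (Step-isConfiguration step c-conf) e-ext run
    with c-ext ← c-conf , letter-kind step
    = c , c-ext , ε , (c-ext , d-ext , _ , step , steps) ∷ path

  run⇒path : ∀ {c w e} → N.ExternalConfiguration c → N.ExternalConfiguration e → Run c w e → Path H c w e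
  run⇒path (c-conf , c-kind) e-ext run with run⇒path′ c-conf e-ext run
  ... | _ , _ , ε , path = path
  -- An ε-step cannot start in the external configuration `c`.
  ... | _ , _ , step ◅ _ , path with () ← trans (sym c-kind) (ε-kind step)

  path-contextSensitive : ∀ {c} → Vertices H c → (F : List (V H)) → All (Vertices H) F →
    ContextSensitive (Language H ｛ c ｝ (_∈ F))
  path-contextSensitive {c} c-vertex F F-vertices = ContextSensitive-resp-≐
    ( (λ { (_ , d , refl , d∈F , path) → d , d∈F , path⇒run path })
    , (λ { (d , d∈F , run) → c , d , refl , d∈F ,
          run⇒path (vertex-external c-vertex) (vertex-external (All.lookup F-vertices d∈F)) run }))
    (run-contextSensitive c (proj₁ (vertex-external c-vertex)) F
      (All.map (λ v → proj₁ (vertex-external v)) F-vertices))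

-- Transport of paths along an isomorphism

module Transport {G H : Graph A} (G≅H : G ≅ H) where
  open _≅_ G≅H
  open Bijection ρ using (to; injective; strictlySurjective)

  -- The isomorphism acts on endpoints of edges only, so a membership proof is passed along the
  -- path; each edge supplies the one for its target.
  path-to : ∀ {x w y} (x-vertex : Vertices H x) → Path H x w y →
    ∃[ y-vertex ] Path G (proj₁ (to (x , x-vertex))) w (proj₁ (to (y , y-vertex)))
  path-to x-vertex [] = x-vertex , []
  path-to {x} x-vertex (_∷_ {y = y} e path)
    with z-vertex , path′ ← path-to {y} (inj₂ (_ , _ , e)) path
    = z-vertex , Equivalence.to (preserves (x , x-vertex) (y , inj₂ (_ , _ , e)) _) e ∷ path′

  path-from : ∀ {w y} (x : Σ (V H) (Vertices H)) {x′} → proj₁ (to x) ≡ x′ → Path G x′ w y →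
    ∃[ z ] proj₁ (to z) ≡ y × Path H (proj₁ x) w (proj₁ z)
  path-from x eq [] = x , eq , []
  path-from x refl (_∷_ {y = y} e path)
    with z , eq ← strictlySurjective (y , inj₂ (_ , _ , e))
    with z′ , eq′ , path′ ← path-from z eq path
    = z′ , eq′ , Equivalence.from (preserves x z _) (subst (edge G _ _) (sym eq) e) ∷ path′

  -- Equality of vertices ignores membership proofs, so injectivity of the isomorphism gives the
  -- equivalence for every `z`, whatever proof it carries.
  finals : (F : List (V G)) → All (Vertices G) F → ∃[ F′ ] All (Vertices H) F′ ×
    (∀ z → (proj₁ z ∈ F′ → proj₁ (to z) ∈ F) × (proj₁ (to z) ∈ F → proj₁ z ∈ F′))
  finals []      []        = [] , [] , λ z → (λ ()) , (λ ())
  finals (y ∷ F) (y-vertex ∷ F-vertices)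
    with F′ , F′-vertices , spec ← finals F F-vertices
    with z , eq ← strictlySurjective (y , y-vertex)
    = proj₁ z ∷ F′ , proj₂ z ∷ F′-vertices , λ z′ →
      (λ { (here eq′) → here (trans (Bijection.cong ρ {z′} {z} eq′) eq)
         ; (there z∈) → there (proj₁ (spec z′) z∈) }) ,
      (λ { (here eq′) → here (injective {z′} {z} (trans eq′ (sym eq)))
         ; (there z∈) → there (proj₂ (spec z′) z∈) })

linearlyBounded⇒contextSensitive : Finite A → (G : Graph A) → LinearlyBounded G →
  (i : V G) → Vertices G i → (F : List (V G)) → All (Vertices G) F →
  ContextSensitive (Language G ｛ i ｝ (_∈ F))
linearlyBounded⇒contextSensitive A-finite G (M , N , G≅H) i i-vertex F F-vertices
  with j@(_ , j-vertex) , ρj≡i ← Bijection.strictlySurjective (_≅_.ρ G≅H) (i , i-vertex)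
  with F′ , F′-vertices , spec ← Transport.finals G≅H F F-vertices
  = ContextSensitive-resp-≐ (there-lang , back-lang)
      (Paths.path-contextSensitive A-finite M N j-vertex F′ F′-vertices)
  where
  open Transport G≅H
  H = transitionGraph M N
  there-lang : ∀ {w} → Language G ｛ i ｝ (_∈ F) w → Language H ｛ proj₁ j ｝ (_∈ F′) w
  there-lang (_ , y , refl , y∈F , path)
    with z , eq , path′ ← path-from j ρj≡i path
    = _ , proj₁ z , refl , proj₂ (spec z) (subst (_∈ F) (sym eq) y∈F) , path′
  back-lang : ∀ {w} → Language H ｛ proj₁ j ｝ (_∈ F′) w → Language G ｛ i ｝ (_∈ F) w
  back-lang (_ , y , refl , y∈F′ , path)
    with y-vertex , path′ ← path-to j-vertex path
    = i , _ , refl , proj₁ (spec (y , y-vertex)) y∈F′ , subst (λ x → Path G x _ _) ρj≡i path′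

-- Machines to graphs

finite⇒≡-dec : Finite A → DecidableEquality A
finite⇒≡-dec A-finite = via-injection (finite⇒countable A-finite) _≟ℕ_

Direction-finite : Finite Direction
Direction-finite = Finite-resp-↔ (mk↔ₛ′
  (λ { ⊕ → nothing ; ⊖ → just tt }) (λ { nothing → ⊕ ; (just tt) → ⊖ })
  (λ { nothing → refl ; (just tt) → refl }) (λ { ⊕ → refl ; ⊖ → refl }))
  (Maybe-finite ⊤-finite)

-- Serves to decide whether a given move is among the rules of an LBM.
Move-finite : Finite Γ → Finite Q → Finite (Move Γ Q)
Move-finite Γ-finite Q-finite = Finite-resp-↔ (mk↔ₛ′
  (λ { (p , X ↦ q , Y , d) → (p , X) , (q , Y) , d }) (λ { ((p , X) , (q , Y) , d) → p , X ↦ q , Y , d })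
  (λ { ((p , X) , (q , Y) , d) → refl }) (λ { (p , X ↦ q , Y , d) → refl }))
  (×-finite side (×-finite side Direction-finite))
  where side = ×-finite Q-finite (Symbol-finite Γ-finite)

-- Decidable reachability in finite graphs

module Reachability {V : Set} {E : V → V → Set} (_≟_ : DecidableEquality V) (E? : Decidable E) where

  -- Warshall: connections with intermediate vertices among the given ones.
  Via : List V → V → V → Set
  Via []       x y = x ≡ y ⊎ E x y
  Via (v ∷ vs) x y = Via vs x y ⊎ (Via vs x v × Via vs v y)

  Via? : ∀ vs → Decidable (Via vs)
  Via? []       x y = (x ≟ y) ⊎-dec E? x y
  Via? (v ∷ vs) x y = Via? vs x y ⊎-dec (Via? vs x v ×-dec Via? vs v y)

  Via⇒Star : ∀ vs {x y} → Via vs x y → Star E x y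
  Via⇒Star []       (inj₁ refl)    = ε
  Via⇒Star []       (inj₂ e)       = e ◅ ε
  Via⇒Star (v ∷ vs) (inj₁ r)       = Via⇒Star vs r
  Via⇒Star (v ∷ vs) (inj₂ (r , s)) = Via⇒Star vs r ◅◅ Via⇒Star vs s

  Via-weaken : ∀ vs {x y} → Via [] x y → Via vs x y
  Via-weaken []       r = r
  Via-weaken (v ∷ vs) r = inj₁ (Via-weaken vs r)

  -- Each intermediate vertex `v` is granted one visit, so when both parts pass through `v`, the
  -- loop between the two visits is dropped.
  Via-trans : ∀ {vs x y z} → y ∈ vs → Via vs x y → Via vs y z → Via vs x z
  Via-trans (here refl) (inj₁ r)       (inj₁ s)       = inj₂ (r , s)
  Via-trans (here refl) (inj₁ r)       (inj₂ (_ , s)) = inj₂ (r , s)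
  Via-trans (here refl) (inj₂ (r , _)) (inj₁ s)       = inj₂ (r , s)
  Via-trans (here refl) (inj₂ (r , _)) (inj₂ (_ , s)) = inj₂ (r , s)
  Via-trans (there y∈)  (inj₁ r)       (inj₁ s)       = inj₁ (Via-trans y∈ r s)
  Via-trans (there y∈)  (inj₁ r)       (inj₂ (s , t)) = inj₂ (Via-trans y∈ r s , t)
  Via-trans (there y∈)  (inj₂ (r , s)) (inj₁ t)       = inj₂ (r , Via-trans y∈ s t)
  Via-trans (there y∈)  (inj₂ (r , _)) (inj₂ (_ , t)) = inj₂ (r , t)

  Star⇒Via : ∀ {vs} → (∀ v → v ∈ vs) → ∀ {x y} → Star E x y → Via vs x y
  Star⇒Via {vs} complete ε              = Via-weaken vs (inj₁ refl)
  Star⇒Via {vs} complete (step ◅ steps) =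
    Via-trans (complete _) (Via-weaken vs (inj₂ step)) (Star⇒Via complete steps)

  Star? : Listable V → Decidable (Star E)
  Star? (vs , complete) x y = map′ (Via⇒Star vs) (Star⇒Via complete) (Via? vs x y)

-- Deciding acceptance of the empty word

module _ (M : LBM A) where
  private module M = LBM M

  -- LBM moves preserve the length of the tape, so on the empty tape a configuration amounts to a
  -- state and one of two head positions.
  Node : Set
  Node = Maybe ⊤ × M.Q

  pattern on⟦ = nothing
  pattern on⟧ = just tt

  node : Node → Conf M.Γ M.Q
  node (on⟦ , q) = start q []
  node (on⟧ , q) = at [] q []

  private
    _⇾_ : Node → Node → Set
    x ⇾ y = ∃[ m ] m ∈ M.δ × m ⊢ₘ node x ⟶ node y

    open DecMembership (finite⇒≡-dec (Move-finite M.Γ-finite M.Q-finite)) using () renaming (_∈?_ to _∈δ?_)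
    open DecMembership (finite⇒≡-dec M.Q-finite) using () renaming (_∈?_ to _∈F?_)

    _⇾?_ : Decidable _⇾_
    (on⟦ , p) ⇾? (on⟧ , q) = map′ (λ m∈δ → _ , m∈δ , start⊕) (λ { (_ , m∈δ , start⊕) → m∈δ })
      ((p , ⟦ ↦ q , ⟦ , ⊕) ∈δ? M.δ)
    (on⟧ , p) ⇾? (on⟦ , q) = map′ (λ m∈δ → _ , m∈δ , end⊖) (λ { (_ , m∈δ , end⊖) → m∈δ })
      ((p , ⟧ ↦ q , ⟧ , ⊖) ∈δ? M.δ)
    (on⟦ , p) ⇾? (on⟦ , q) = no λ { (_ , _ , ()) }
    (on⟧ , p) ⇾? (on⟧ , q) = no λ { (_ , _ , ()) }

    Node-finite : Finite Node
    Node-finite = ×-finite (Maybe-finite ⊤-finite) M.Q-finite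

    nodes : Listable Node
    nodes = finite⇒listable Node-finite

    ⟶*⇒⇾* : ∀ {x z} → Star (_⟶_ M) (node x) z → ∃[ y ] z ≡ node y × Star _⇾_ x y
    ⟶*⇒⇾* ε = _ , refl , ε
    ⟶*⇒⇾* {on⟦ , p} ((m , m∈δ , start⊕) ◅ steps) with y , eq , steps′ ← ⟶*⇒⇾* {on⟧ , _} steps =
      y , eq , (m , m∈δ , start⊕) ◅ steps′
    ⟶*⇒⇾* {on⟧ , p} ((m , m∈δ , end⊖) ◅ steps) with y , eq , steps′ ← ⟶*⇒⇾* {on⟦ , _} steps =
      y , eq , (m , m∈δ , end⊖) ◅ steps′

    Accepting : Pred Node 0ℓ
    Accepting y = proj₂ y ∈ M.F × Star _⇾_ (on⟦ , M.q₀) y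

    Accepting? : ∀ y → Dec (Accepting y)
    Accepting? y = (proj₂ y ∈F? M.F) ×-dec
      Reachability.Star? (finite⇒≡-dec Node-finite) _⇾?_ nodes (on⟦ , M.q₀) y

  state-node : ∀ y → state (node y) ≡ proj₂ y
  state-node (on⟦ , q) = refl
  state-node (on⟧ , q) = refl

  accepts-[]? : Dec (AcceptsConf M [])
  accepts-[]? = map′ to from (any? Accepting? (proj₁ nodes))
    where
    to : Any Accepting (proj₁ nodes) → AcceptsConf M []
    to any with y , _ , q∈F , steps ← find any =
      node y , subst (_∈ M.F) (sym (state-node y)) q∈F , gmap node id steps
    from : AcceptsConf M [] → Any Accepting (proj₁ nodes)
    from (z , q∈F , steps) with y , refl , steps′ ← ⟶*⇒⇾* {on⟦ , M.q₀} steps =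
      lose (proj₂ nodes y) (subst (_∈ M.F) (state-node y) q∈F , steps′)

private
  pattern 7F = Fin.suc 6F

∷ʳ-ʳ++ : ∀ (xs : List A) {ys y} → xs ʳ++ ys ++ [ y ] ≡ (xs ʳ++ ys) ++ [ y ]
∷ʳ-ʳ++ []       = refl
∷ʳ-ʳ++ (x ∷ xs) = ∷ʳ-ʳ++ xs

-- Changes the state only; the direction is one that is possible at every
-- position of the head.
turn : Q → Q → Symbol Γ → Move Γ Q
turn p q ⟦     = p , ⟦ ↦ q , ⟦ , ⊕
turn p q (` X) = p , ` X ↦ q , ` X , ⊖
turn p q ⟧     = p , ⟧ ↦ q , ⟧ , ⊖

turn-valid : ∀ {p q : Q} (X : Symbol Γ) → ValidMove (turn p q X)
turn-valid ⟦     = left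
turn-valid (` X) = inner
turn-valid ⟧     = right

turned : ∀ {P : Set} → Conf Γ P → Q → Conf Γ Q
turned (start _ γ) q = at [] q γ
turned (at α _ β)  q = retreat α q β

scanned : List Γ → Symbol Γ
scanned []      = ⟧
scanned (X ∷ β) = ` X

symbol : Conf Γ Q → Symbol Γ
symbol (start _ γ) = ⟦
symbol (at α _ β)  = scanned β

turn-step : ∀ (z : Conf Γ Q) q → turn (state z) q (symbol z) ⊢ₘ z ⟶ turned z q
turn-step (start p γ)      q = start⊕
turn-step (at α p [])      q = end⊖
turn-step (at α p (X ∷ β)) q = at⊖

turn-step⁻ : ∀ {p q : Q} (X : Symbol Γ) {z z′} → turn p q X ⊢ₘ z ⟶ z′ →
  p ≡ state z × X ≡ symbol z × z′ ≡ turned z q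
turn-step⁻ ⟦     start⊕ = refl , refl , refl
turn-step⁻ (` X) at⊖    = refl , refl , refl
turn-step⁻ ⟧     end⊖   = refl , refl , refl

state-turned : ∀ {P : Set} (z : Conf Γ P) (q : Q) → state (turned z q) ≡ q
state-turned (start _ γ)      q = refl
state-turned (at [] _ β)      q = refl
state-turned (at (C ∷ α) _ β) q = refl

content-turned : ∀ {P : Set} (z : Conf Γ P) (q : Q) → content (turned z q) ≡ content z
content-turned (start _ γ)      q = refl
content-turned (at [] _ β)      q = refl
content-turned (at (C ∷ α) _ β) q = refl

state-retreat : ∀ (α : List Γ) {q : Q} {β} → state (retreat α q β) ≡ q
state-retreat []      = refl
state-retreat (C ∷ α) = refl

reset : ∀ {P : Set} → Q → Conf Γ P → Conf Γ Q
reset q (start _ γ) = start q γ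
reset q (at α _ β)  = at α q β

reset-retreat : ∀ {P : Set} {p : P} {q : Q} (α : List Γ) β → reset q (retreat α p β) ≡ retreat α q β
reset-retreat []      β = refl
reset-retreat (C ∷ α) β = refl

-- The LLBM built from an LBM

module FromLBM (A-finite : Finite A) (B : LBM A) where
  private module B = LBM B

  open Injection B.input using () renaming (to to cell)

  -- In `ret`, right after an insertion, the machine guesses whether that letter was the last:
  -- `proceed` goes back to `read`, `stop` prepares the simulation. The purpose of `junk` is to give
  -- `fin` an outgoing edge, and `dead` absorbs the moves that totality demands.
  State : Set
  State = B.Q ⊎ Fin 8

  pattern sim q  = inj₁ q
  pattern read   = inj₂ 0F
  pattern ret    = inj₂ 1F
  pattern rewind = inj₂ 2F
  pattern begin  = inj₂ 3F
  pattern erase  = inj₂ 4F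
  pattern fin    = inj₂ 5F
  pattern junk   = inj₂ 6F
  pattern dead   = inj₂ 7F

  kind : State → Kind
  kind read = external
  kind fin  = external
  kind junk = external
  kind _    = internal

  -- Lets `die` range over all states without giving an external state an ε-rule, which
  -- normalization forbids.
  inner-state : State → State
  inner-state p with kind p
  ... | external = dead
  ... | internal = p

  kind-inner-state : ∀ p → kind (inner-state p) ≡ internal
  kind-inner-state p with kind p in eq
  ... | external = refl
  ... | internal = eq

  inner-state-internal : ∀ p → kind p ≡ internal → inner-state p ≡ p
  inner-state-internal p eq with kind p | eq
  ... | internal | refl = refl

  data Instruction : Set where
    read-letter : A → Instruction
    proceed     : B.Γ → Instruction
    stop        : Symbol B.Γ → Instruction
    to-left     : Symbol B.Γ → Instruction
    at-left     : ⊤ → Instruction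
    launch      : Symbol B.Γ → Instruction
    simulate    : Member B.δ → Instruction
    accept      : Member B.F × Symbol B.Γ → Instruction
    wander      : Symbol B.Γ → Instruction
    drop        : B.Γ → Instruction
    finish      : ⊤ → Instruction
    leave       : A → Instruction
    die         : State × Symbol B.Γ → Instruction

  simulated : Move B.Γ B.Q → Move B.Γ State
  simulated (p , X ↦ q , Y , d) = sim p , X ↦ sim q , Y , d

  ⟪_⟫ : Instruction → Rule A B.Γ State
  ⟪ read-letter a ⟫          = insert read ⟧ a ret (cell a)
  ⟪ proceed X ⟫              = move (ret , ` X ↦ read , ` X , ⊕)
  ⟪ stop X ⟫                 = move (turn ret rewind X)
  ⟪ to-left X ⟫              = move (turn rewind rewind X)
  -- A move on `⟦` always goes right, but the LBM starts on `⟦`; hence the detour through `begin`,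
  -- from which `launch` steps back.
  ⟪ at-left _ ⟫              = move (turn rewind begin ⟦)
  ⟪ launch X ⟫               = move (turn begin (sim B.q₀) X)
  ⟪ simulate (m , _) ⟫       = move (simulated m)
  ⟪ accept ((q , _) , X) ⟫   = move (turn (sim q) erase X)
  ⟪ wander X ⟫               = move (turn erase erase X)
  ⟪ drop X ⟫                 = delete erase X erase
  -- This may happen before the tape is empty, but the configuration reached is then not `final`.
  ⟪ finish _ ⟫               = move (turn erase fin ⟦)
  ⟪ leave a ⟫                = insert fin ⟧ a junk (cell a)
  ⟪ die (p , X) ⟫            = move (turn (inner-state p) dead X)

  State-finite : Finite State
  State-finite = ⊎-finite B.Q-finite Fin-finite

  opaque
    Instruction-listable : Listable Instruction
    Instruction-listable = members families , complete
      where
      letters : Listable A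
      letters = finite⇒listable A-finite
      tape-symbols : Listable B.Γ
      tape-symbols = finite⇒listable B.Γ-finite
      symbols : Listable (Symbol B.Γ)
      symbols = finite⇒listable (Symbol-finite B.Γ-finite)
      families : List (Family Instruction)
      families =
        (_ , letters , read-letter) ∷
        (_ , tape-symbols , proceed) ∷
        (_ , symbols , stop) ∷
        (_ , symbols , to-left) ∷
        (_ , ⊤-listable , at-left) ∷
        (_ , symbols , launch) ∷
        (_ , Member-listable B.δ , simulate) ∷
        (_ , ×-listable (Member-listable B.F) symbols , accept) ∷
        (_ , symbols , wander) ∷
        (_ , tape-symbols , drop) ∷
        (_ , ⊤-listable , finish) ∷
        (_ , letters , leave) ∷
        (_ , ×-listable (finite⇒listable State-finite) symbols , die) ∷ []
      cover : ∀ {P l f} → (P , l , f) ∈ families → ∀ p → f p ∈ members families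
      cover = ∈-members {fs = families}
      complete : ∀ i → i ∈ members families
      complete (read-letter x) = cover (here refl) x
      complete (proceed x) = cover (there (here refl)) x
      complete (stop x) = cover (there (there (here refl))) x
      complete (to-left x) = cover (there (there (there (here refl)))) x
      complete (at-left x) = cover (there (there (there (there (here refl))))) x
      complete (launch x) = cover (there (there (there (there (there (here refl)))))) x
      complete (simulate x) = cover (there (there (there (there (there (there (here refl))))))) x
      complete (accept x) = cover (there (there (there (there (there (there (there (here refl)))))))) x
      complete (wander x) = cover (there (there (there (there (there (there (there (there (here refl))))))))) x
      complete (drop x) = cover (there (there (there (there (there (there (there (there (there (here refl)))))))))) x
      complete (finish x) = cover (there (there (there (there (there (there (there (there (there (there (here refl))))))))))) x
      complete (leave x) = cover (there (there (there (there (there (there (there (there (there (there (there (here refl)))))))))))) x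
      complete (die x) = cover (there (there (there (there (there (there (there (there (there (there (there (there (here refl))))))))))))) x

  simulated-valid : ∀ {m} → ValidMove m → ValidMove (simulated m)
  simulated-valid inner = inner
  simulated-valid left  = left
  simulated-valid right = right

  ⟪⟫-valid : ∀ i → ValidRule ⟪ i ⟫
  ⟪⟫-valid (read-letter _)        = insert⟧
  ⟪⟫-valid (proceed _)            = move inner
  ⟪⟫-valid (stop X)               = move (turn-valid X)
  ⟪⟫-valid (to-left X)            = move (turn-valid X)
  ⟪⟫-valid (at-left _)            = move left
  ⟪⟫-valid (launch X)             = move (turn-valid X)
  ⟪⟫-valid (simulate (_ , m∈δ))   = move (simulated-valid (All.lookup B.δ-valid m∈δ))
  ⟪⟫-valid (accept (_ , X))       = move (turn-valid X)
  ⟪⟫-valid (wander X)             = move (turn-valid X)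
  ⟪⟫-valid (drop _)               = delete
  ⟪⟫-valid (finish _)             = move left
  ⟪⟫-valid (leave _)              = insert⟧
  ⟪⟫-valid (die (_ , X))          = move (turn-valid X)

  label-kind : Maybe A → Kind
  label-kind nothing  = internal
  label-kind (just _) = external

  source-turn : ∀ {p q : State} (X : Symbol B.Γ) → source {A} (move (turn p q X)) ≡ p
  source-turn ⟦     = refl
  source-turn (` X) = refl
  source-turn ⟧     = refl

  source-kind : ∀ i → kind (source ⟪ i ⟫) ≡ label-kind (label ⟪ i ⟫)
  source-kind (read-letter _)  = refl
  source-kind (proceed _)      = refl
  source-kind (stop X)         = cong kind (source-turn X)
  source-kind (to-left X)      = cong kind (source-turn X)
  source-kind (at-left _)      = refl
  source-kind (launch X)       = cong kind (source-turn X)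
  source-kind (simulate ((p , X ↦ q , Y , d) , _)) = refl
  source-kind (accept (_ , X)) = cong kind (source-turn X)
  source-kind (wander X)       = cong kind (source-turn X)
  source-kind (drop _)         = refl
  source-kind (finish _)       = refl
  source-kind (leave _)        = refl
  source-kind (die (p , X))    = trans (cong kind (source-turn X)) (kind-inner-state p)

  machine : LLBM A
  machine = record
    { Γ = B.Γ ; Q = State ; Γ-finite = B.Γ-finite ; Q-finite = State-finite
    ; input = B.input ; q₀ = read ; F = fin ∷ []
    ; δ = map ⟪_⟫ (proj₁ Instruction-listable)
    ; δ-valid = map⁺ (All.tabulate λ {i} _ → ⟪⟫-valid i)
    }

  private module M = LLBM machine

  ⟪⟫∈δ : ∀ i → ⟪ i ⟫ ∈ M.δ
  ⟪⟫∈δ i = ∈-map⁺ ⟪_⟫ (proj₂ Instruction-listable i)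

  normalized : Normalized machine
  normalized = record
    { kind          = kind
    ; F-external    = refl ∷ []
    ; letter-source = λ r∈δ eq → kind-of r∈δ eq
    ; ε-source      = λ r∈δ eq → kind-of r∈δ eq
    ; total         = total
    }
    where
    kind-of : ∀ {r x} → r ∈ M.δ → label r ≡ x → kind (source r) ≡ label-kind x
    kind-of r∈δ refl with i , _ , refl ← ∈-map⁻ ⟪_⟫ r∈δ = source-kind i
    total : ∀ p X → kind p ≡ internal → ∃[ q ] ∃[ Y ] ∃[ d ] move (p , X ↦ q , Y , d) ∈ M.δ
    total p X eq with ⟪⟫∈δ (die (p , X))
    ... | die∈δ rewrite inner-state-internal p eq with X
    ... | ⟦   = _ , _ , _ , die∈δ
    ... | ` X = _ , _ , _ , die∈δ
    ... | ⟧   = _ , _ , _ , die∈δ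

  graph : Graph A
  graph = transitionGraph machine normalized

  word : List A → List B.Γ
  word = map cell

  infix 4 _⟶ᴮ*_
  _⟶ᴮ*_ : Conf B.Γ B.Q → Conf B.Γ B.Q → Set
  _⟶ᴮ*_ = Star (_⟶_ B)

  -- What holds in state q with the head as in z after reading w.
  Invariant : List A → State → ∀ {P} → Conf B.Γ P → Set
  Invariant w (sim q) z           = start₀ B w ⟶ᴮ* reset q z
  Invariant w read    (start _ γ) = ⊥
  Invariant w read    (at α _ β)  = β ≡ [] × α ʳ++ β ≡ word w
  Invariant w ret     (start _ γ) = ⊥
  Invariant w ret     (at α _ β)  = ∃[ X ] β ≡ [ X ] × α ʳ++ β ≡ word w
  Invariant w rewind  z           = content z ≡ word w
  Invariant w begin   (start _ γ) = ⊥
  Invariant w begin   (at α _ β)  = α ≡ [] × β ≡ word w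
  Invariant w erase   z           = AcceptsConf B w
  Invariant w fin     z           = AcceptsConf B w
  Invariant w junk    z           = ⊤
  Invariant w dead    z           = ⊤

  _·_ : List A → Maybe A → List A
  w · nothing = w
  w · just a  = w ++ [ a ]

  -- The invariant is stated for a variable state q since state (turned z q)
  -- does not compute.
  Preserved : List A → Conf B.Γ State → Set
  Preserved w z = ∃[ q ] q ≡ state z × Invariant w q z

  preserved-turn : ∀ {w p q z z′} (X : Symbol B.Γ) → turn p q X ⊢ₘ z ⟶ z′ →
    (p ≡ state z → X ≡ symbol z → Invariant w q (turned z q)) → Preserved w z′
  preserved-turn {q = q} {z} X step inv with refl , refl , refl ← turn-step⁻ X step =
    q , sym (state-turned z q) , inv refl refl

  word-∷ʳ : ∀ {α} w {a} → α ʳ++ [] ≡ word w → α ʳ++ [ cell a ] ≡ word (w ++ [ a ])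
  word-∷ʳ {α} w {a} eq =
    trans (∷ʳ-ʳ++ α) (trans (cong (_++ [ cell a ]) eq) (sym (map-++ cell w [ a ])))

  simulation-accepts : ∀ {w q} (z : Conf B.Γ State) → q ∈ B.F → start₀ B w ⟶ᴮ* reset q z → AcceptsConf B w
  simulation-accepts (start _ γ) q∈F steps = start _ γ , q∈F , steps
  simulation-accepts (at α _ β)  q∈F steps = at α _ β , q∈F , steps

  ret-content : ∀ {w} (z : Conf B.Γ State) → Invariant w ret z → content z ≡ word w
  ret-content (at α _ β) (_ , _ , eq) = eq

  begin-launch : ∀ {w} (z : Conf B.Γ State) → Invariant w begin z →
    Invariant w (sim B.q₀) (turned {Q = State} z (sim B.q₀))
  begin-launch (at α _ β) (refl , refl) = ε

  preserved-simulated : ∀ {m w z z′} → m ∈ B.δ → simulated m ⊢ₘ z ⟶ z′ →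
    Invariant w (state z) z → Preserved w z′
  preserved-simulated {p , _ ↦ q , _ , _} m∈δ start⊕ inv = _ , refl , inv ◅◅ (_ , m∈δ , start⊕) ◅ ε
  preserved-simulated {p , _ ↦ q , _ , _} m∈δ at⊕    inv = _ , refl , inv ◅◅ (_ , m∈δ , at⊕) ◅ ε
  preserved-simulated {p , _ ↦ q , _ , _} m∈δ (at⊖ {α = α} {β}) inv =
    _ , sym (state-retreat α) , subst (_ ⟶ᴮ*_) (sym (reset-retreat α _)) (inv ◅◅ (_ , m∈δ , at⊖) ◅ ε)
  preserved-simulated {p , _ ↦ q , _ , _} m∈δ (end⊖ {α = α}) inv =
    _ , sym (state-retreat α) , subst (_ ⟶ᴮ*_) (sym (reset-retreat α _)) (inv ◅◅ (_ , m∈δ , end⊖) ◅ ε)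

  -- Until the simulation starts, the tape itself spells the word. Then the invariant records a run
  -- of the LBM, and finally mere acceptance, which survives the erasing of the tape.
  preserved : ∀ i {w z z′} → ⟪ i ⟫ ⊢ z ⟶ z′ → Invariant w (state z) z → Preserved (w · label ⟪ i ⟫) z′
  preserved (read-letter a) {w} (insert⟧ {α = α}) (_ , eq) =
    ret , refl , cell a , refl , word-∷ʳ {α} w eq
  preserved (proceed X) (move at⊕) (_ , refl , eq) = read , refl , refl , eq
  preserved (stop X) {w} {z} (move step) inv = preserved-turn X step λ where
    eq _ → trans (content-turned z rewind) (ret-content z (subst (λ q → Invariant w q z) (sym eq) inv))
  preserved (to-left X) {w} {z} (move step) inv = preserved-turn X step λ where
    eq _ → trans (content-turned z rewind) (subst (λ q → Invariant w q z) (sym eq) inv)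
  preserved (at-left _) (move start⊕) inv = begin , refl , refl , inv
  preserved (launch X) {w} {z} (move step) inv = preserved-turn X step λ where
    eq _ → begin-launch z (subst (λ q → Invariant w q z) (sym eq) inv)
  preserved (simulate (m , m∈δ)) (move step) inv = preserved-simulated m∈δ step inv
  preserved (accept ((q , q∈F) , X)) {w} {z} (move step) inv = preserved-turn X step λ where
    eq _ → simulation-accepts z q∈F (subst (λ q → Invariant w q z) (sym eq) inv)
  preserved (wander X) {w} {z} (move step) inv = preserved-turn X step λ where
    eq _ → subst (λ q → Invariant w q z) (sym eq) inv
  preserved (drop X) delete inv = erase , refl , inv
  preserved (finish _) (move start⊕) inv = fin , refl , inv
  preserved (leave a) insert⟧ inv = junk , refl , tt
  preserved (die (p , X)) (move step) inv = preserved-turn X step λ _ _ → tt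

  Reaches : List A → Triple B.Γ State → Set
  Reaches w c = ∃[ z ] c ≡ ⌊ z ⌋ × Invariant w (state z) z

  step-preserves : ∀ {w x c d} → M.Step x c d → Reaches w c → Reaches (w · x) d
  step-preserves (_ , r∈δ , refl , step) (z , refl , inv)
    with i , _ , refl ← ∈-map⁻ ⟪_⟫ r∈δ
    with z′ , eq , step′ ← ⌊⌋-rule⁻ z (⟪⟫-valid i) step
    with _ , refl , inv′ ← preserved i step′ inv = z′ , eq , inv′

  ε*-preserves : ∀ {w c d} → Star (M.Step nothing) c d → Reaches w c → Reaches w d
  ε*-preserves ε              r = r
  ε*-preserves (step ◅ steps) r = ε*-preserves steps (step-preserves step r)

  path-preserves : ∀ {w w′ c d} → Path graph c w′ d → Reaches w c → Reaches (w ++ w′) d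
  path-preserves {w} [] r = subst (λ w → Reaches w _) (sym (++-identityʳ w)) r
  path-preserves {w} {d = d} (_∷_ {a = a} {w = w′} (_ , _ , _ , step , steps) path) r =
    subst (λ w → Reaches w d) (++-assoc w [ a ] w′)
      (path-preserves path (ε*-preserves steps (step-preserves step r)))

  initial final : Triple B.Γ State
  initial = ⌊ at [] read [] ⌋
  final   = ⌊ at [] fin [] ⌋

  initial-reaches : Reaches [] initial
  initial-reaches = at [] read [] , refl , refl , refl

  reaches-final : ∀ {w} → Reaches w final → AcceptsConf B w
  reaches-final (at α _ β , eq , inv) with refl ← cong (proj₁ ∘ proj₂) eq = inv

  -- In state `read` the tape spells the word read so far, and here it is empty. Hence making
  -- `initial` a final vertex adds the empty word and nothing else.
  reaches-initial : ∀ {w} → Reaches w initial → w ≡ []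
  reaches-initial {[]}    _ = refl
  reaches-initial {a ∷ w} (at [] _ β , eq , inv)
    with refl ← cong (proj₁ ∘ proj₂) eq
    with refl , () ← inv
  reaches-initial {a ∷ w} (at (X ∷ α) _ β , eq , inv)
    with _ , () ← ∷ʳ-injective [] (before α) (cong proj₁ eq)

  infix 4 _⟹_ _⟹*_
  _⟹_ : Conf B.Γ State → Conf B.Γ State → Set
  z ⟹ z′ = ∃[ i ] label ⟪ i ⟫ ≡ nothing × ⟪ i ⟫ ⊢ z ⟶ z′

  _⟹*_ : Conf B.Γ State → Conf B.Γ State → Set
  _⟹*_ = Star _⟹_

  ⟹*⇒ε* : ∀ {z z′} → z ⟹* z′ → Star (M.Step nothing) ⌊ z ⌋ ⌊ z′ ⌋
  ⟹*⇒ε* = gmap ⌊_⌋ λ (i , eq , step) → ⟪ i ⟫ , ⟪⟫∈δ i , eq , ⌊⌋-rule step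

  turn⟹ : ∀ z q → ∃[ i ] ⟪ i ⟫ ≡ move (turn (state z) q (symbol z)) → z ⟹ turned z q
  turn⟹ z q (i , eq) = i , cong label eq , subst (_⊢ z ⟶ turned z q) (sym eq) (move (turn-step z q))

  go-left : ∀ {p} → (∀ X → ∃[ i ] ⟪ i ⟫ ≡ move (turn p p X)) →
    ∀ α β → retreat α p β ⟹* start p (α ʳ++ β)
  go-left turn-p []      β = ε
  go-left turn-p (C ∷ α) β = turn⟹ (at α _ (C ∷ β)) _ (turn-p (` C)) ◅ go-left turn-p α (C ∷ β)

  lift : Conf B.Γ B.Q → Conf B.Γ State
  lift z = reset (sim (state z)) z

  lift-retreat : ∀ α q β → retreat α (sim q) β ≡ lift (retreat α q β)
  lift-retreat []      q β = refl
  lift-retreat (C ∷ α) q β = refl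

  lift⟹ : ∀ {z z′} → _⟶_ B z z′ → lift z ⟹ lift z′
  lift⟹ (m , m∈δ , start⊕) = simulate (m , m∈δ) , refl , move start⊕
  lift⟹ (m , m∈δ , at⊕)    = simulate (m , m∈δ) , refl , move at⊕
  lift⟹ {z} (m , m∈δ , at⊖ {α = α}) =
    simulate (m , m∈δ) , refl , subst (_ ⊢ lift z ⟶_) (lift-retreat α _ _) (move at⊖)
  lift⟹ {z} (m , m∈δ , end⊖ {α = α}) =
    simulate (m , m∈δ) , refl , subst (_ ⊢ lift z ⟶_) (lift-retreat α _ _) (move end⊖)

  erase-all : ∀ γ → at [] erase γ ⟹* at [] fin []
  erase-all []      = turn⟹ (at [] erase []) erase (wander ⟧ , refl) ◅
    turn⟹ (start erase []) fin (finish tt , refl) ◅ ε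
  erase-all (X ∷ γ) = (drop X , refl , delete) ◅ erase-all γ

  accepting : ∀ z → state z ∈ B.F → lift z ⟹* at [] fin []
  accepting z@(start q γ) q∈F =
    turn⟹ (lift z) erase (accept ((q , q∈F) , ⟦) , refl) ◅ erase-all γ
  accepting z@(at α q β) q∈F =
    turn⟹ (lift z) erase (accept ((q , q∈F) , scanned β) , refl) ◅
    go-left (λ X → wander X , refl) α β ◅◅
    turn⟹ (start erase _) erase (wander ⟦ , refl) ◅ erase-all _

  launching : ∀ α X → at α ret [ X ] ⟹* lift (start B.q₀ (α ʳ++ [ X ]))
  launching α X =
    turn⟹ (at α ret [ X ]) rewind (stop (` X) , refl) ◅
    go-left (λ X → to-left X , refl) α [ X ] ◅◅
    turn⟹ (start rewind _) begin (at-left tt , refl) ◅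
    turn⟹ (at [] begin _) (sim B.q₀) (launch _ , refl) ◅ ε

  external-⌊⌋ : ∀ z → kind (state z) ≡ external → Normalized.ExternalConfiguration normalized ⌊ z ⌋
  external-⌊⌋ z@(start _ _) eq = ⌊⌋-isConfiguration z , eq
  external-⌊⌋ z@(at _ _ _)  eq = ⌊⌋-isConfiguration z , eq

  letter-edge : ∀ {α a z} → at α ret [ cell a ] ⟹* z → kind (state z) ≡ external →
    edge graph ⌊ at α read [] ⌋ a ⌊ z ⌋
  letter-edge {α} {a} {z} steps eq = external-⌊⌋ (at α read []) refl , external-⌊⌋ z eq , _ ,
    (⟪ read-letter a ⟫ , ⟪⟫∈δ (read-letter a) , refl , ⌊⌋-rule {z = at α read []} insert⟧) , ⟹*⇒ε* steps

  -- `α` is the reversed tape before `a` is read. All letters but the last give short edges through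
  -- `proceed`; the edge of the last one carries the rewinding, the accepting run and the erasing.
  reading : ∀ {w} → AcceptsConf B w → ∀ α a w′ → α ʳ++ word (a ∷ w′) ≡ word w →
    Path graph ⌊ at α read [] ⌋ (a ∷ w′) final
  reading (z , q∈F , steps) α a [] eq = letter-edge (launching α (cell a) ◅◅
    subst (λ γ → lift (start B.q₀ γ) ⟹* _) (sym eq) (gmap lift lift⟹ steps) ◅◅ accepting z q∈F) refl ∷ []
  reading accepts α a (b ∷ w′) eq = proceeding ∷ reading accepts (cell a ∷ α) b w′ eq
    where
    proceeding : edge graph ⌊ at α read [] ⌋ a ⌊ at (cell a ∷ α) read [] ⌋
    proceeding = letter-edge {α} ((proceed (cell a) , refl , move at⊕) ◅ ε) refl

  initial-vertex : A → Vertices graph initial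
  initial-vertex a = inj₁ (a , ⌊ at [ cell a ] read [] ⌋ ,
    letter-edge {[]} ((proceed (cell a) , refl , move at⊕) ◅ ε) refl)

  -- The outgoing edge given by `leave` is used, as an incoming edge would depend on the LBM
  -- accepting some word.
  final-vertex : A → Vertices graph final
  final-vertex a = inj₁ (a , ⌊ at [] junk [ cell a ] ⌋ , external-⌊⌋ (at [] fin []) refl ,
    external-⌊⌋ (at [] junk [ cell a ]) refl , _ ,
    (⟪ leave a ⟫ , ⟪⟫∈δ (leave a) , refl , insert) , ε)

≅-refl : {G : Graph A} → G ≅ G
≅-refl = record { ρ = bijection _ ; preserves = λ x y a → ⇔-id _ }

-- A letter is assumed because over the empty alphabet a graph has no edges, hence no vertex to
-- serve as the initial one.
contextSensitive⇒linearlyBounded : Finite A → A → (L : Pred (List A) 0ℓ) → ContextSensitive L →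
  Σ (Graph A) λ G → LinearlyBounded G × (∃[ i ] Vertices G i × (∃[ F ] All (Vertices G) F ×
    L ≐ Language G ｛ i ｝ (_∈ F)))
contextSensitive⇒linearlyBounded {A} A-finite a L (B , L⊆B , B⊆L) =
  graph , (machine , normalized , ≅-refl) , initial , initial-vertex a , finals
  where
  open FromLBM A-finite B

  accepts : ∀ {w} → L w → AcceptsConf B w
  accepts l = proj₂ (AcceptsConf≐Accepts B) (L⊆B l)

  member : ∀ {w} → AcceptsConf B w → L w
  member x = B⊆L (proj₁ (AcceptsConf≐Accepts B) x)

  finals : ∃[ F ] All (Vertices graph) F × L ≐ Language graph ｛ initial ｝ (_∈ F)
  finals with accepts-[]? B
  ... | yes accepts-[] =
    initial ∷ final ∷ [] , initial-vertex a ∷ final-vertex a ∷ [] ,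
    (λ { {[]} l → _ , _ , refl , here refl , []
       ; {b ∷ w} l → _ , _ , refl , there (here refl) , reading (accepts l) [] b w refl }) ,
    λ { (_ , _ , refl , here refl , path) →
          subst L (sym (reaches-initial (path-preserves path initial-reaches))) (member accepts-[])
      ; (_ , _ , refl , there (here refl) , path) →
          member (reaches-final (path-preserves path initial-reaches)) }
  ... | no ¬accepts-[] =
    final ∷ [] , final-vertex a ∷ [] ,
    (λ { {[]} l → contradiction (accepts l) ¬accepts-[]
       ; {b ∷ w} l → _ , _ , refl , here refl , reading (accepts l) [] b w refl }) ,
    λ { (_ , _ , refl , here refl , path) → member (reaches-final (path-preserves path initial-reaches)) }

proposition7 : (A : Set) → Finite A →
    ((G : Graph A) → LinearlyBounded G →
    (i : V G) → Vertices G i →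
    (F : List (V G)) → All (Vertices G) F →
    ContextSensitive (Language G ｛ i ｝ (_∈ F)))
    ×
    (A → (L : Pred (List A) 0ℓ) → ContextSensitive L →
    Σ (Graph A) λ G → LinearlyBounded G ×
    (∃[ i ] Vertices G i × (∃[ F ] All (Vertices G) F ×
    L ≐ Language G ｛ i ｝ (_∈ F))))
proposition7 A A-finite =
  linearlyBounded⇒contextSensitive A-finite ,
  contextSensitive⇒linearlyBounded A-finite
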